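{- Let $b$ be a computable real with $0<b<\frac12$, and let $d:\{0,1,2\}^*\to[0,1]$ be given by $d(\lambda)=1$, $d(\sigma^\frown i)=b\cdot d(\sigma)$ for $i\in\{0,1\}$ and $d(\sigma^\frown 2)=(1-2b)\cdot d(\sigma)$, for all $\sigma\in\{0,1,2\}^*$. Then there is an effectively closed set $Q\subseteq2^{\mathbb{N}}$ with Lebesgue measure zero and positive capacity $\mathcal{T}_d(Q)>0$.
   Context: Lebesgue measure on $2^{\mathbb{N}}$ is the fair-coin measure. A set $Q\subseteq 2^{\mathbb{N}}$ is effectively closed (a $\Pi^0_1$ class) if it is the set of infinite paths through some computable tree $T\subseteq\{0,1\}^*$. For $\sigma\in\{0,1\}^*$, $I(\sigma)=\{x\in2^{\mathbb{N}}:\sigma\sqsubset x\}$. $\lambda$ is the empty string, $^\frown$ is concatenation. $\mathcal{C}$ is the space of nonempty closed subsets of $2^{\mathbb{N}}$. Codes of closed sets: for $Q\in\mathcal{C}$ let $T_Q=\{\sigma\in\{0,1\}^*: Q\cap I(\sigma)\ne\emptyset\}$, and let $\sigma_0,\sigma_1,\dots$ enumerate $T_Q$ first by length and then lexicographically. The code $x_Q\in\{0,1,2\}^{\mathbb{N}}$ is given by: $x_Q(n)=2$ if both $\sigma_n{}^\frown 0,\sigma_n{}^\frown 1\in T_Q$; $x_Q(n)=1$ if only $\sigma_n{}^\frown 1\in T_Q$; $x_Q(n)=0$ if only $\sigma_n{}^\frown 0\in T_Q$. The map $Q\mapsto x_Q$ is a bijection (indeed a homeomorphism for the hit-or-miss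 topology) from $\mathcal{C}$ onto $\{0,1,2\}^{\mathbb{N}}$. Measure and capacity: $\mu_d$ is the Borel probability measure on $\{0,1,2\}^{\mathbb{N}}$ giving the cylinder of $\sigma\in\{0,1,2\}^*$ measure $d(\sigma)$; $\mu_d^*(\mathcal{X})=\mu_d(\{x_Q:Q\in\mathcal{X}\})$ for Borel $\mathcal{X}\subseteq\mathcal{C}$; and $\mathcal{T}_d(Q)=\mu_d^*(\{K\in\mathcal{C}:K\cap Q\ne\emptyset\})$ for closed $Q\subseteq2^{\mathbb{N}}$. -}

module Defs where

open import Level using (Level; Lift; _⊔_) renaming (zero to 0ℓ; suc to lsuc)
open import Data.Nat.Base as ℕ using (ℕ; zero; suc)
import Data.Nat.Properties as ℕ
open import Data.Integer.Base as ℤ using (-1ℤ)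
open import Data.Rational.Base as ℚ using (ℚ; 0ℚ; 1ℚ; ½; ∣_∣)
import Data.Rational.Properties as ℚ
open import Data.Rational.Solver using (module +-*-Solver)
open import Data.Fin.Base as Fin using (Fin; toℕ)
open import Data.Fin.Patterns using (0F; 1F; 2F)
open import Data.List.Base using (List; []; _∷_; _++_; _∷ʳ_; length; foldr; applyUpTo)
open import Data.List.Relation.Binary.Lex.Strict using (Lex-<)
open import Data.Vec.Base as Vec using (Vec; []; _∷_)
open import Data.Product.Base using (∃; ∃-syntax; Σ-syntax; _×_; _,_)
open import Data.Sum.Base using (_⊎_)
open import Relation.Nullary using (¬_)
open import Relation.Unary using (Pred; _∈_; _∉_; _≐_; _≬_; ∁; ⋃; Satisfiable)
open import Relation.Unary.Polymorphic using (U)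
open import Relation.Binary.PropositionalEquality
  using (_≡_; _≢_; refl; sym; trans; cong; cong₂; subst)

-- A real is a Cauchy sequence of rationals; _≈_ says the difference tends to 0.

Cauchy : (ℕ → ℚ) → Set
Cauchy x = ∀ ε → 0ℚ ℚ.< ε →
  ∃[ N ] ∀ m n → N ℕ.≤ m → N ℕ.≤ n → ∣ x m ℚ.- x n ∣ ℚ.≤ ε

record ℝ : Set where
  constructor mkℝ
  field
    seq    : ℕ → ℚ
    cauchy : Cauchy seq

open ℝ public

infix 4 _≈_ _≤_ _<_

_≈_ : ℝ → ℝ → Set
x ≈ y = ∀ ε → 0ℚ ℚ.< ε → ∃[ N ] ∀ n → N ℕ.≤ n → ∣ seq x n ℚ.- seq y n ∣ ℚ.≤ ε

_≤_ : ℝ → ℝ → Set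
x ≤ y = ∀ ε → 0ℚ ℚ.< ε → ∃[ N ] ∀ n → N ℕ.≤ n → seq x n ℚ.≤ seq y n ℚ.+ ε

_<_ : ℝ → ℝ → Set
x < y = ∃[ ε ] (0ℚ ℚ.< ε × ∃[ N ] ∀ n → N ℕ.≤ n → seq x n ℚ.+ ε ℚ.≤ seq y n)

abstract
  open ℚ.≤-Reasoning

  *-pos : ∀ {p q} → 0ℚ ℚ.< p → 0ℚ ℚ.< q → 0ℚ ℚ.< p ℚ.* q
  *-pos {p} {q} 0<p 0<q = ℚ.positive⁻¹ (p ℚ.* q) {{ℚ.pos*pos⇒pos p {{ℚ.positive 0<p}} q {{ℚ.positive 0<q}}}}

  +-pos : ∀ {p q} → 0ℚ ℚ.< p → 0ℚ ℚ.< q → 0ℚ ℚ.< p ℚ.+ q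
  +-pos {p} {q} 0<p 0<q = ℚ.+-mono-< 0<p 0<q

  0<1 : 0ℚ ℚ.< 1ℚ
  0<1 = ℚ.positive⁻¹ 1ℚ

  0<½ : 0ℚ ℚ.< ½
  0<½ = ℚ.positive⁻¹ ½

  *-mono-≤ : ∀ {p q r s} → 0ℚ ℚ.≤ p → 0ℚ ℚ.≤ s → p ℚ.≤ q → r ℚ.≤ s → p ℚ.* r ℚ.≤ q ℚ.* s
  *-mono-≤ {p} {q} {r} {s} 0≤p 0≤s p≤q r≤s = ℚ.≤-trans
    (ℚ.*-monoˡ-≤-nonNeg p {{ℚ.nonNegative 0≤p}} r≤s)
    (ℚ.*-monoʳ-≤-nonNeg s {{ℚ.nonNegative 0≤s}} p≤q)

  ½+½ : ∀ ε → ½ ℚ.* ε ℚ.+ ½ ℚ.* ε ≡ ε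
  ½+½ ε = trans (sym (ℚ.*-distribʳ-+ ε ½ ½)) (ℚ.*-identityˡ ε)

  eventually-bounded : ∀ x → Cauchy x →
    ∃[ B ] (0ℚ ℚ.< B × ∃[ N ] ∀ n → N ℕ.≤ n → ∣ x n ∣ ℚ.≤ B)
  eventually-bounded x c with c 1ℚ 0<1
  ... | N , h = ∣ x N ∣ ℚ.+ 1ℚ
              , ℚ.+-mono-≤-< (ℚ.0≤∣p∣ (x N)) 0<1
              , N , λ n N≤n → begin
      ∣ x n ∣                          ≡⟨ cong ∣_∣ (eq (x n) (x N)) ⟩
      ∣ x N ℚ.+ (x n ℚ.- x N) ∣        ≤⟨ ℚ.∣p+q∣≤∣p∣+∣q∣ (x N) _ ⟩
      ∣ x N ∣ ℚ.+ ∣ x n ℚ.- x N ∣      ≤⟨ ℚ.+-monoʳ-≤ ∣ x N ∣ (h n N N≤n ℕ.≤-refl) ⟩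
      ∣ x N ∣ ℚ.+ 1ℚ                   ∎
    where
    open +-*-Solver
    eq : ∀ a b → a ≡ b ℚ.+ (a ℚ.- b)
    eq = solve 2 (λ a b → a := b :+ (a :- b)) refl

  +-cauchy : ∀ x y → Cauchy x → Cauchy y → Cauchy (λ n → x n ℚ.+ y n)
  +-cauchy x y cx cy ε 0<ε with cx (½ ℚ.* ε) (*-pos 0<½ 0<ε) | cy (½ ℚ.* ε) (*-pos 0<½ 0<ε)
  ... | M , hx | N , hy = M ℕ.⊔ N , λ m n M⊔N≤m M⊔N≤n → begin
      ∣ (x m ℚ.+ y m) ℚ.- (x n ℚ.+ y n) ∣      ≡⟨ cong ∣_∣ (eq (x m) (y m) (x n) (y n)) ⟩
      ∣ (x m ℚ.- x n) ℚ.+ (y m ℚ.- y n) ∣      ≤⟨ ℚ.∣p+q∣≤∣p∣+∣q∣ (x m ℚ.- x n) _ ⟩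
      ∣ x m ℚ.- x n ∣ ℚ.+ ∣ y m ℚ.- y n ∣
        ≤⟨ ℚ.+-mono-≤ (hx m n (ℕ.m⊔n≤o⇒m≤o M N M⊔N≤m) (ℕ.m⊔n≤o⇒m≤o M N M⊔N≤n))
                      (hy m n (ℕ.m⊔n≤o⇒n≤o M N M⊔N≤m) (ℕ.m⊔n≤o⇒n≤o M N M⊔N≤n)) ⟩
      ½ ℚ.* ε ℚ.+ ½ ℚ.* ε                      ≡⟨ ½+½ ε ⟩
      ε                                        ∎
    where
    open +-*-Solver
    eq : ∀ a b c d → (a ℚ.+ b) ℚ.- (c ℚ.+ d) ≡ (a ℚ.- c) ℚ.+ (b ℚ.- d)
    eq = solve 4 (λ a b c d → (a :+ b) :- (c :+ d) := (a :- c) :+ (b :- d)) refl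

  neg-cauchy : ∀ x → Cauchy x → Cauchy (λ n → ℚ.- x n)
  neg-cauchy x cx ε 0<ε with cx ε 0<ε
  ... | N , h = N , λ m n N≤m N≤n → begin
      ∣ ℚ.- x m ℚ.- ℚ.- x n ∣    ≡⟨ cong ∣_∣ (sym (ℚ.neg-distrib-+ (x m) (ℚ.- x n))) ⟩
      ∣ ℚ.- (x m ℚ.- x n) ∣      ≡⟨ ℚ.∣-p∣≡∣p∣ (x m ℚ.- x n) ⟩
      ∣ x m ℚ.- x n ∣            ≤⟨ h m n N≤m N≤n ⟩
      ε                          ∎

  product-bound : ∀ a b c d P Q δ → 0ℚ ℚ.≤ Q → 0ℚ ℚ.≤ δ →
    ∣ a ∣ ℚ.≤ P → ∣ d ∣ ℚ.≤ Q → ∣ a ℚ.- c ∣ ℚ.≤ δ → ∣ b ℚ.- d ∣ ℚ.≤ δ →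
    ∣ (a ℚ.* b) ℚ.- (c ℚ.* d) ∣ ℚ.≤ (P ℚ.+ Q) ℚ.* δ
  product-bound a b c d P Q δ 0≤Q 0≤δ a≤P d≤Q ac bd = begin
      ∣ (a ℚ.* b) ℚ.- (c ℚ.* d) ∣
        ≡⟨ cong ∣_∣ (eq a b c d) ⟩
      ∣ a ℚ.* (b ℚ.- d) ℚ.+ (a ℚ.- c) ℚ.* d ∣
        ≤⟨ ℚ.∣p+q∣≤∣p∣+∣q∣ (a ℚ.* (b ℚ.- d)) ((a ℚ.- c) ℚ.* d) ⟩
      ∣ a ℚ.* (b ℚ.- d) ∣ ℚ.+ ∣ (a ℚ.- c) ℚ.* d ∣
        ≡⟨ cong₂ ℚ._+_ (ℚ.∣p*q∣≡∣p∣*∣q∣ a (b ℚ.- d)) (ℚ.∣p*q∣≡∣p∣*∣q∣ (a ℚ.- c) d) ⟩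
      ∣ a ∣ ℚ.* ∣ b ℚ.- d ∣ ℚ.+ ∣ a ℚ.- c ∣ ℚ.* ∣ d ∣
        ≤⟨ ℚ.+-mono-≤ (*-mono-≤ (ℚ.0≤∣p∣ a) 0≤δ a≤P bd)
                      (*-mono-≤ (ℚ.0≤∣p∣ (a ℚ.- c)) 0≤Q ac d≤Q) ⟩
      P ℚ.* δ ℚ.+ δ ℚ.* Q
        ≡⟨ eq′ P Q δ ⟩
      (P ℚ.+ Q) ℚ.* δ ∎
    where
    open +-*-Solver
    eq : ∀ a b c d → (a ℚ.* b) ℚ.- (c ℚ.* d) ≡ a ℚ.* (b ℚ.- d) ℚ.+ (a ℚ.- c) ℚ.* d
    eq = solve 4 (λ a b c d → (a :* b) :- (c :* d) := a :* (b :- d) :+ (a :- c) :* d) refl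
    eq′ : ∀ p q d → p ℚ.* d ℚ.+ d ℚ.* q ≡ (p ℚ.+ q) ℚ.* d
    eq′ = solve 3 (λ p q d → p :* d :+ d :* q := (p :+ q) :* d) refl

  divide : ∀ B ε → 0ℚ ℚ.< B → 0ℚ ℚ.< ε → ∃[ δ ] (0ℚ ℚ.< δ × B ℚ.* δ ≡ ε)
  divide B ε 0<B 0<ε = B⁻¹ ℚ.* ε , *-pos (ℚ.positive⁻¹ B⁻¹ {{ℚ.1/pos⇒pos B {{B>0}}}}) 0<ε ,
    trans (sym (ℚ.*-assoc B B⁻¹ ε))
      (trans (cong (ℚ._* ε) (ℚ.*-inverseʳ B {{B≢0}})) (ℚ.*-identityˡ ε))
    where
    B>0 : ℚ.Positive B
    B>0 = ℚ.positive 0<B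
    B≢0 : ℚ.NonZero B
    B≢0 = ℚ.pos⇒nonZero B {{B>0}}
    B⁻¹ : ℚ
    B⁻¹ = (ℚ.1/ B) {{B≢0}}

  *-cauchy : ∀ x y → Cauchy x → Cauchy y → Cauchy (λ n → x n ℚ.* y n)
  *-cauchy x y cx cy ε 0<ε =
    let P , 0<P , N₁ , bx = eventually-bounded x cx
        Q , 0<Q , N₂ , by = eventually-bounded y cy
        δ , 0<δ , Bδ≡ε    = divide (P ℚ.+ Q) ε (+-pos 0<P 0<Q) 0<ε
        N₃ , hx           = cx δ 0<δ
        N₄ , hy           = cy δ 0<δ
        K                 = N₁ ℕ.⊔ N₂
        L                 = N₃ ℕ.⊔ N₄
    in K ℕ.⊔ L , λ m n N≤m N≤n →
      let K≤m = ℕ.m⊔n≤o⇒m≤o K L N≤m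
          K≤n = ℕ.m⊔n≤o⇒m≤o K L N≤n
          L≤m = ℕ.m⊔n≤o⇒n≤o K L N≤m
          L≤n = ℕ.m⊔n≤o⇒n≤o K L N≤n
      in subst (∣ (x m ℚ.* y m) ℚ.- (x n ℚ.* y n) ∣ ℚ.≤_) Bδ≡ε
           (product-bound (x m) (y m) (x n) (y n) P Q δ (ℚ.<⇒≤ 0<Q) (ℚ.<⇒≤ 0<δ)
             (bx m (ℕ.m⊔n≤o⇒m≤o N₁ N₂ K≤m))
             (by n (ℕ.m⊔n≤o⇒n≤o N₁ N₂ K≤n))
             (hx m n (ℕ.m⊔n≤o⇒m≤o N₃ N₄ L≤m) (ℕ.m⊔n≤o⇒m≤o N₃ N₄ L≤n))
             (hy m n (ℕ.m⊔n≤o⇒n≤o N₃ N₄ L≤m) (ℕ.m⊔n≤o⇒n≤o N₃ N₄ L≤n)))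

infixl 6 _+_ _-_
infixl 7 _*_

_+_ _-_ _*_ : ℝ → ℝ → ℝ
x + y = mkℝ (λ n → seq x n ℚ.+ seq y n) (+-cauchy (seq x) (seq y) (cauchy x) (cauchy y))
x - y = mkℝ (λ n → seq x n ℚ.- seq y n)
          (+-cauchy (seq x) (λ n → ℚ.- seq y n) (cauchy x) (neg-cauchy (seq y) (cauchy y)))
x * y = mkℝ (λ n → seq x n ℚ.* seq y n) (*-cauchy (seq x) (seq y) (cauchy x) (cauchy y))

fromℚ : ℚ → ℝ
fromℚ q = mkℝ (λ _ → q) λ ε 0<ε → 0 , λ _ _ _ _ →
  subst (ℚ._≤ ε) (sym (cong ∣_∣ (ℚ.+-inverseʳ q))) (ℚ.<⇒≤ 0<ε)

0ℝ 1ℝ ½ℝ 2ℝ : ℝ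
0ℝ = fromℚ 0ℚ
1ℝ = fromℚ 1ℚ
½ℝ = fromℚ ½
2ℝ = fromℚ (1ℚ ℚ.+ 1ℚ)

½^_ : ℕ → ℚ
½^ zero  = 1ℚ
½^ suc n = ½ ℚ.* ½^ n

partialSum : (ℕ → ℝ) → ℕ → ℝ
partialSum a zero    = 0ℝ
partialSum a (suc n) = partialSum a n + a n

HasSum : (ℕ → ℝ) → ℝ → Set
HasSum a s = ∀ ε → 0ℚ ℚ.< ε → ∃[ N ] ∀ n → N ℕ.≤ n →
  partialSum a n ≤ s + fromℚ ε × s ≤ partialSum a n + fromℚ ε

-- Kleene's schemes for the partial recursive functions.

data Rec : ℕ → Set where
  zer  : ∀ {n} → Rec n
  succ : Rec 1
  proj : ∀ {n} → Fin n → Rec n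
  comp : ∀ {m n} → Rec m → Vec (Rec n) m → Rec n
  prec : ∀ {n} → Rec n → Rec (2 ℕ.+ n) → Rec (1 ℕ.+ n)
  μmin : ∀ {n} → Rec (1 ℕ.+ n) → Rec n

infix 4 _[_]↓_

-- f [ xs ]↓ y: the function denoted by f is defined at xs, with value y.
data _[_]↓_ : ∀ {n} → Rec n → Vec ℕ n → ℕ → Set where
  zer↓  : ∀ {n} {xs : Vec ℕ n} → zer [ xs ]↓ 0
  succ↓ : ∀ {x} → succ [ x ∷ [] ]↓ suc x
  proj↓ : ∀ {n} {i : Fin n} {xs} → proj i [ xs ]↓ Vec.lookup xs i
  comp↓ : ∀ {m n} {f : Rec m} {gs : Vec (Rec n) m} {xs ys z} →
          (∀ i → Vec.lookup gs i [ xs ]↓ Vec.lookup ys i) →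
          f [ ys ]↓ z → comp f gs [ xs ]↓ z
  prec↓-zero : ∀ {n} {g : Rec n} {h xs y} →
               g [ xs ]↓ y → prec g h [ 0 ∷ xs ]↓ y
  prec↓-suc  : ∀ {n} {g : Rec n} {h k xs y z} →
               prec g h [ k ∷ xs ]↓ y → h [ k ∷ y ∷ xs ]↓ z →
               prec g h [ suc k ∷ xs ]↓ z
  μmin↓ : ∀ {n} {f : Rec (1 ℕ.+ n)} {xs y} →
          f [ y ∷ xs ]↓ 0 →
          (∀ k → k ℕ.< y → ∃[ v ] f [ k ∷ xs ]↓ suc v) →
          μmin f [ xs ]↓ y

Computable : (ℕ → ℕ) → Set
Computable f = ∃[ e ] ∀ n → e [ n ∷ [] ]↓ f n

-- rₖ = (-1)^s(k) · p(k) / (q(k) + 1) with s, p, q recursive.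
ComputableℚSeq : (ℕ → ℚ) → Set
ComputableℚSeq r = ∃[ s ] ∃[ p ] ∃[ q ] (Computable s × Computable p × Computable q ×
  (∀ k → r k ≡ ((-1ℤ ℤ.^ s k) ℤ.* (ℤ.+ p k)) ℚ./ suc (q k)))

ComputableReal : ℝ → Set
ComputableReal x = ∃[ r ] (ComputableℚSeq r × (∀ k →
  x ≤ fromℚ (r k) + fromℚ (½^ k) × fromℚ (r k) ≤ x + fromℚ (½^ k)))

-- Bijective base-2 numeration: a bijection from {0,1}* onto ℕ.
code : List (Fin 2) → ℕ
code = foldr (λ i c → 1 ℕ.+ toℕ i ℕ.+ 2 ℕ.* c) 0

ComputableSet : Pred (List (Fin 2)) 0ℓ → Set
ComputableSet T = ∃[ e ] ∀ σ →
  (σ ∈ T → e [ code σ ∷ [] ]↓ 1) × (σ ∉ T → e [ code σ ∷ [] ]↓ 0)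

Seq : Set → Set
Seq A = ℕ → A

infix 5 _↾_
_↾_ : {A : Set} → Seq A → ℕ → List A
x ↾ n = applyUpTo x n

infix 4 _⊏_
_⊏_ : {A : Set} → List A → Seq A → Set
σ ⊏ x = x ↾ length σ ≡ σ

I : ∀ {ℓ} {A : Set} → List A → Pred (Seq A) ℓ
I {ℓ} σ x = Lift ℓ (σ ⊏ x)

Open : ∀ {ℓ} {A : Set} → Pred (Seq A) ℓ → Set ℓ
Open V = ∀ x → x ∈ V → ∃[ n ] ∀ y → y ↾ n ≡ x ↾ n → y ∈ V

-- K contains each of its adherent points.
Closed : ∀ {ℓ} {A : Set} → Pred (Seq A) ℓ → Set ℓ
Closed K = ∀ x → (∀ n → ∃[ y ] (y ∈ K × y ↾ n ≡ x ↾ n)) → x ∈ K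

IsTree : Pred (List (Fin 2)) 0ℓ → Set
IsTree T = ∀ σ τ → σ ++ τ ∈ T → σ ∈ T

Paths : Pred (List (Fin 2)) 0ℓ → Pred (Seq (Fin 2)) 0ℓ
Paths T x = ∀ n → x ↾ n ∈ T

EffectivelyClosed : Pred (Seq (Fin 2)) 0ℓ → Set₁
EffectivelyClosed Q = ∃[ T ] (IsTree T × ComputableSet T × Q ≐ Paths T)

data Borel {ℓ} {A : Set} : Pred (Seq A) ℓ → Set (lsuc ℓ) where
  open-set   : ∀ {V} → Open V → Borel V
  complement : ∀ {B} → Borel B → Borel (∁ B)
  union      : ∀ {B : ℕ → Pred (Seq A) ℓ} → (∀ i → Borel (B i)) → Borel (⋃ ℕ B)
  resp-≐     : ∀ {B C : Pred (Seq A) ℓ} → B ≐ C → Borel B → Borel C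

-- μ is total, but nothing is required of it outside the Borel sets.
record BorelProbability (ℓ : Level) (A : Set) : Set (lsuc ℓ) where
  field
    μ          : Pred (Seq A) ℓ → ℝ
    μ-cong     : ∀ {B C} → Borel B → Borel C → B ≐ C → μ B ≈ μ C
    μ-nonneg   : ∀ {B} → Borel B → 0ℝ ≤ μ B
    μ-total    : μ U ≈ 1ℝ
    σ-additive : ∀ (B : ℕ → Pred (Seq A) ℓ) → (∀ i → Borel (B i)) →
                 (∀ i j → i ≢ j → ¬ (B i ≬ B j)) →
                 HasSum (λ i → μ (B i)) (μ (⋃ ℕ B))

open BorelProbability public

-- The cylinders are a π-system generating the Borel sets, so on Borel sets there
-- is at most one m with given cylinder values: "the" measure with those values.
HasCylinderValues : ∀ {ℓ} {A : Set} → BorelProbability ℓ A → (List A → ℝ) → Set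
HasCylinderValues m d = ∀ σ → μ m (I σ) ≈ d σ

IsFairCoin : ∀ {ℓ} → BorelProbability ℓ (Fin 2) → Set
IsFairCoin m = HasCylinderValues m (λ σ → fromℚ (½^ length σ))

Nodes : Pred (Seq (Fin 2)) 0ℓ → Pred (List (Fin 2)) 0ℓ
Nodes K σ = K ≬ (σ ⊏_)

-- First by length, then lexicographically.
infix 4 _≺_
_≺_ : List (Fin 2) → List (Fin 2) → Set
σ ≺ τ = length σ ℕ.< length τ ⊎ (length σ ≡ length τ × Lex-< _≡_ Fin._<_ σ τ)

record Enumerates (s : ℕ → List (Fin 2)) (T : Pred (List (Fin 2)) 0ℓ) : Set where
  field
    increasing : ∀ m n → m ℕ.< n → s m ≺ s n
    sound      : ∀ n → s n ∈ T
    complete   : ∀ σ → σ ∈ T → ∃[ n ] s n ≡ σ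

record IsCode (K : Pred (Seq (Fin 2)) 0ℓ) (x : Seq (Fin 3)) : Set where
  field
    node       : ℕ → List (Fin 2)
    enumerates : Enumerates node (Nodes K)
    both       : ∀ n → node n ∷ʳ 0F ∈ Nodes K → node n ∷ʳ 1F ∈ Nodes K → x n ≡ 2F
    only-1     : ∀ n → node n ∷ʳ 0F ∉ Nodes K → node n ∷ʳ 1F ∈ Nodes K → x n ≡ 1F
    only-0     : ∀ n → node n ∷ʳ 0F ∈ Nodes K → node n ∷ʳ 1F ∉ Nodes K → x n ≡ 0F

-- The set of codes of the nonempty closed sets lying in 𝒳. It quantifies over
-- predicates, hence lives one universe up.
Codes : Pred (Pred (Seq (Fin 2)) 0ℓ) 0ℓ → Pred (Seq (Fin 3)) (lsuc 0ℓ)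
Codes 𝒳 x = ∃[ K ] (Satisfiable K × Closed K × K ∈ 𝒳 × IsCode K x)

capacity : BorelProbability (lsuc 0ℓ) (Fin 3) → Pred (Seq (Fin 2)) 0ℓ → ℝ
capacity m Q = μ m (Codes (_≬ Q))

{-# OPTIONS --safe #-}
module Submission where

open import Defs
open import Level using (Level; Lift; lift; lower) renaming (zero to 0ℓ; suc to lsuc)
open import Axiom.DoubleNegationElimination using (em⇒dne)
open import Axiom.ExcludedMiddle using (ExcludedMiddle)
open import Data.Empty using (⊥-elim)
open import Data.Fin.Base as Fin using (Fin; toℕ)
open import Data.Fin.Patterns using (0F; 1F; 2F)
import Data.Fin.Properties as Fin
import Data.Integer.Base as ℤ
import Data.Integer.Properties as ℤ
open import Data.List.Base using (List; []; _∷_; [_]; _++_; _∷ʳ_; drop; foldl; initLast; length; _∷ʳ′_)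
open import Data.List.Membership.Propositional using () renaming (_∈_ to _∈ₗ_)
open import Data.List.Membership.Propositional.Properties using (∈-∃++; ∈-++⁺ˡ; ∈-++⁺ʳ; ∈-++⁻)
import Data.List.Properties as List
open import Data.List.Relation.Binary.Lex.Strict using (Lex-<; base; this; next; <-transitive; <-irreflexive)
open import Data.List.Relation.Binary.Pointwise using (≡⇒Pointwise-≡)
open import Data.List.Relation.Unary.All as All using (All; []; _∷_)
import Data.List.Relation.Unary.All.Properties as All
open import Data.List.Relation.Unary.AllPairs as AllPairs using (AllPairs; []; _∷_)
import Data.List.Relation.Unary.AllPairs.Properties as AllPairs
open import Data.List.Relation.Unary.Any using (here; there)
open import Data.Nat.Base as ℕ using (ℕ; zero; suc)
open import Data.Nat.Coprimality as Coprime using (1-coprimeTo)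
open import Data.Nat.Induction using (<-rec)
import Data.Nat.Properties as ℕ
open import Data.Product.Base using (∃-syntax; _×_; _,_; proj₁; proj₂)
open import Data.Rational.Base as ℚ using (ℚ; mkℚ; *≤*; 0ℚ; 1ℚ; ½; ∣_∣)
import Data.Rational.Properties as ℚ
open import Data.Rational.Solver using (module +-*-Solver)
open import Data.Rational.Unnormalised.Base using (*≡*)
import Data.Rational.Unnormalised.Properties as ℚᵘ
open import Data.Sum.Base using (_⊎_; inj₁; inj₂)
open import Data.Unit.Base using (⊤; tt)
open import Data.Vec.Base using (Vec; []; _∷_)
open import Relation.Binary.Bundles using (Poset)
open import Relation.Binary.Definitions using (tri<; tri≈; tri>)
open import Relation.Binary.PropositionalEquality
  using (_≡_; _≢_; refl; sym; trans; cong; cong₂; subst; subst₂; isEquivalence; resp₂)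
import Relation.Binary.Reasoning.PartialOrder as PosetReasoning
open import Relation.Nullary using (¬_; Dec; yes; no; contradiction)
open import Relation.Nullary.Decidable using (map′; _×-dec_)
open import Relation.Unary using (Pred; _∈_; _∉_; _⊆_; _≐_; _≬_; ⋃; ⋂; _∪_; _∩_; _∖_)
open import Relation.Unary.Polymorphic using (∅)

open +-*-Solver using (Polynomial; solve; con; _:=_; _:+_; _:*_; _:-_; :-_)

-- Let T be the tree of strings whose entries at the multiples of p + 1 are all 1, and
-- Q its set of paths. Q is null, since its measure is halved at each of these positions.
--
-- Reading a code digit by digit generates the nodes of the coded tree in a queue. Each
-- node of the queue gets a weight h ≤ 1 which is 0 off T and satisfies
-- h(σ) ≤ c h(σ0) + c h(σ1) + (1 - 2c)(h(σ0) + h(σ1) - h(σ0) h(σ1)) for a rational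
-- c = 1/2 - ε ≥ b, hence also for b. Then 1 - ∏ (1 - h(σ)), over the queue, is a
-- submartingale which starts at h(λ) and is 0 as soon as no node of T is left in the
-- queue. So the queue meets T at every time with probability at least h(λ) > 0, and by
-- compactness this is the event that the coded set meets Q.
--
-- For σ in T with j free positions left before the next forced 1, take
-- h(σ) = min(1/2, 1/4 + j ε/4); the condition at a forced position needs a child of
-- weight 1/2, which exists if p is large.

-- Real numbers

-- Why a null set can be hit: a node of the random tree has on average `2b + 2(1 - 2b) = 2 - 2b`
-- children, more than 1 because `b < 1/2`. A forced 1 cuts this mean to `1 - b` at a single level,
-- and a long enough free stretch makes up for the loss, whereas Lebesgue measure is halved at every
-- forced position however rare these are. The condition on `h` only asks for a lower solution of
-- the recursion satisfied by survival probabilities, so no such probability has to be computed. The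
-- obstacle is that digits are attached to nodes in the order of discovery: the digits describing a
-- given subtree sit at positions that depend on the code, which makes the independence of subtrees
-- awkward to express. The queue avoids it. One digit changes one factor of the product, and a
-- one-digit inequality, summed over cylinders, replaces every appeal to independence.

0≤p+q : ∀ {p q} → 0ℚ ℚ.≤ p → 0ℚ ℚ.≤ q → 0ℚ ℚ.≤ p ℚ.+ q
0≤p+q 0≤p 0≤q = ℚ.+-mono-≤ 0≤p 0≤q

0≤p*q : ∀ {p q} → 0ℚ ℚ.≤ p → 0ℚ ℚ.≤ q → 0ℚ ℚ.≤ p ℚ.* q
0≤p*q {p} {q} 0≤p 0≤q =
  ℚ.nonNegative⁻¹ (p ℚ.* q) {{ℚ.nonNeg*nonNeg⇒nonNeg p {{ℚ.nonNegative 0≤p}} q {{ℚ.nonNegative 0≤q}}}}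

p+e≡q⇒p≤q : ∀ {p q e} → 0ℚ ℚ.≤ e → p ℚ.+ e ≡ q → p ℚ.≤ q
p+e≡q⇒p≤q {p} {q} 0≤e eq = subst₂ ℚ._≤_ (ℚ.+-identityʳ p) eq (ℚ.+-monoʳ-≤ p 0≤e)

p≤q⇒0≤q-p : ∀ {p q} → p ℚ.≤ q → 0ℚ ℚ.≤ q ℚ.- p
p≤q⇒0≤q-p {p} {q} p≤q = subst (ℚ._≤ q ℚ.- p) (ℚ.+-inverseʳ p) (ℚ.+-monoˡ-≤ (ℚ.- p) p≤q)

p≤∣p∣ : ∀ p → p ℚ.≤ ∣ p ∣
p≤∣p∣ p with ℚ.≤-total 0ℚ p
... | inj₁ 0≤p = ℚ.≤-reflexive (sym (ℚ.0≤p⇒∣p∣≡p 0≤p))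
... | inj₂ p≤0 = ℚ.≤-trans p≤0 (ℚ.0≤∣p∣ p)

∣p-q∣≤e⇒p≤q+e : ∀ p q {e} → ∣ p ℚ.- q ∣ ℚ.≤ e → p ℚ.≤ q ℚ.+ e
∣p-q∣≤e⇒p≤q+e p q {e} h =
  subst (ℚ._≤ q ℚ.+ e) (solve 2 (λ p q → q :+ (p :- q) := p) refl p q)
    (ℚ.+-monoʳ-≤ q (ℚ.≤-trans (p≤∣p∣ (p ℚ.- q)) h))

∣p-q∣-comm : ∀ p q → ∣ p ℚ.- q ∣ ≡ ∣ q ℚ.- p ∣
∣p-q∣-comm p q = trans (sym (ℚ.∣-p∣≡∣p∣ (p ℚ.- q)))
  (cong ∣_∣ (solve 2 (λ p q → :- (p :- q) := q :- p) refl p q))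

∣p-q∣≤e : ∀ p q {e} → p ℚ.≤ q ℚ.+ e → q ℚ.≤ p ℚ.+ e → ∣ p ℚ.- q ∣ ℚ.≤ e
∣p-q∣≤e p q {e} p≤ q≤ with ℚ.∣p∣≡p∨∣p∣≡-p (p ℚ.- q)
... | inj₁ eq = subst (ℚ._≤ e) (sym eq)
  (subst (p ℚ.- q ℚ.≤_) (solve 2 (λ q e → (q :+ e) :- q := e) refl q e) (ℚ.+-monoˡ-≤ (ℚ.- q) p≤))
... | inj₂ eq = subst (ℚ._≤ e) (sym eq)
  (subst₂ ℚ._≤_ (solve 2 (λ p q → q :- p := :- (p :- q)) refl p q)
                (solve 2 (λ p e → (p :+ e) :- p := e) refl p e) (ℚ.+-monoˡ-≤ (ℚ.- p) q≤))

Eventually : (ℕ → Set) → Set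
Eventually P = ∃[ N ] ∀ n → N ℕ.≤ n → P n

ev-map₂ : ∀ {P Q R : ℕ → Set} → (∀ n → P n → Q n → R n) →
          Eventually P → Eventually Q → Eventually R
ev-map₂ f (M , p) (N , q) = M ℕ.⊔ N , λ n h →
  f n (p n (ℕ.m⊔n≤o⇒m≤o M N h)) (q n (ℕ.m⊔n≤o⇒n≤o M N h))

ev-map : ∀ {P Q : ℕ → Set} → (∀ n → P n → Q n) → Eventually P → Eventually Q
ev-map f (N , p) = N , λ n h → f n (p n h)

0<½ε : ∀ {ε} → 0ℚ ℚ.< ε → 0ℚ ℚ.< ½ ℚ.* ε
0<½ε 0<ε = *-pos 0<½ 0<ε

infix 4 _≲_ _≅_

-- _≤_ and _≈_ unfold to function types, from which Agda cannot infer the two reals;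
-- the wrappers make them inferable.
record _≲_ (x y : ℝ) : Set where
  constructor ⟨_⟩
  field un≲ : x ≤ y
open _≲_ public

record _≅_ (x y : ℝ) : Set where
  constructor _&_
  field
    ≅⇒≲ : x ≲ y
    ≅⇒≳ : y ≲ x
open _≅_ public

≈⇒≅ : ∀ {x y} → x ≈ y → x ≅ y
≈⇒≅ {x} {y} h = ⟨ (λ ε 0<ε → ev-map (λ n → ∣p-q∣≤e⇒p≤q+e (seq x n) (seq y n)) (h ε 0<ε)) ⟩ &
  ⟨ (λ ε 0<ε → ev-map (λ n p → ∣p-q∣≤e⇒p≤q+e (seq y n) (seq x n)
                          (subst (ℚ._≤ ε) (∣p-q∣-comm (seq x n) (seq y n)) p)) (h ε 0<ε)) ⟩

≅⇒≈ : ∀ {x y} → x ≅ y → x ≈ y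
≅⇒≈ {x} {y} (⟨ h ⟩ & ⟨ k ⟩) ε 0<ε = ev-map₂ (λ n → ∣p-q∣≤e (seq x n) (seq y n)) (h ε 0<ε) (k ε 0<ε)

eventually⇒≲ : ∀ {x y} → Eventually (λ n → seq x n ℚ.≤ seq y n) → x ≲ y
eventually⇒≲ h = ⟨ (λ ε 0<ε → ev-map (λ _ p → ℚ.≤-trans p (p+e≡q⇒p≤q (ℚ.<⇒≤ 0<ε) refl)) h) ⟩

pointwise⇒≅ : ∀ {x y} → (∀ n → seq x n ≡ seq y n) → x ≅ y
pointwise⇒≅ h = eventually⇒≲ (0 , λ n _ → ℚ.≤-reflexive (h n))
              & eventually⇒≲ (0 , λ n _ → ℚ.≤-reflexive (sym (h n)))

≲-trans : ∀ {x y z} → x ≲ y → y ≲ z → x ≲ z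
≲-trans {x} {y} {z} ⟨ h ⟩ ⟨ k ⟩ = ⟨ (λ ε 0<ε → ev-map₂
  (λ n p q → ℚ.≤-trans p (subst (seq y n ℚ.+ ½ ℚ.* ε ℚ.≤_)
    (trans (ℚ.+-assoc (seq z n) _ _) (cong (seq z n ℚ.+_) (½+½ ε))) (ℚ.+-monoˡ-≤ (½ ℚ.* ε) q)))
  (h _ (0<½ε 0<ε)) (k _ (0<½ε 0<ε))) ⟩

≅-refl : ∀ {x} → x ≅ x
≅-refl = pointwise⇒≅ (λ _ → refl)

≅-sym : ∀ {x y} → x ≅ y → y ≅ x
≅-sym (h & k) = k & h

≅-trans : ∀ {x y z} → x ≅ y → y ≅ z → x ≅ z
≅-trans (h & k) (h′ & k′) = ≲-trans h h′ & ≲-trans k′ k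

ℝ-poset : Poset 0ℓ 0ℓ 0ℓ
ℝ-poset = record
  { Carrier = ℝ
  ; _≈_ = _≅_
  ; _≤_ = _≲_
  ; isPartialOrder = record
    { isPreorder = record
      { isEquivalence = record { refl = ≅-refl ; sym = ≅-sym ; trans = ≅-trans }
      ; reflexive = ≅⇒≲
      ; trans = ≲-trans
      }
    ; antisym = _&_
    }
  }

module ≲-Reasoning = PosetReasoning ℝ-poset

≲-refl : ∀ {x} → x ≲ x
≲-refl = ≅⇒≲ ≅-refl

+-mono : ∀ {x y z w} → x ≲ y → z ≲ w → x + z ≲ y + w
+-mono {x} {y} {z} {w} ⟨ h ⟩ ⟨ k ⟩ = ⟨ (λ ε 0<ε → ev-map₂
  (λ n p q → subst (seq x n ℚ.+ seq z n ℚ.≤_)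
    (trans (solve 3 (λ y w e → (y :+ e) :+ (w :+ e) := (y :+ w) :+ (e :+ e)) refl
             (seq y n) (seq w n) (½ ℚ.* ε))
           (cong (seq y n ℚ.+ seq w n ℚ.+_) (½+½ ε)))
    (ℚ.+-mono-≤ p q))
  (h _ (0<½ε 0<ε)) (k _ (0<½ε 0<ε))) ⟩

+-cong : ∀ {x y z w} → x ≅ y → z ≅ w → x + z ≅ y + w
+-cong (h & k) (h′ & k′) = +-mono h h′ & +-mono k k′

+-comm : ∀ x y → x + y ≅ y + x
+-comm x y = pointwise⇒≅ (λ n → ℚ.+-comm (seq x n) (seq y n))

+-assoc : ∀ x y z → (x + y) + z ≅ x + (y + z)
+-assoc x y z = pointwise⇒≅ (λ n → ℚ.+-assoc (seq x n) (seq y n) (seq z n))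

+-identityˡ : ∀ x → 0ℝ + x ≅ x
+-identityˡ x = pointwise⇒≅ (λ n → ℚ.+-identityˡ (seq x n))

+-identityʳ : ∀ x → x + 0ℝ ≅ x
+-identityʳ x = pointwise⇒≅ (λ n → ℚ.+-identityʳ (seq x n))

+-cancelʳ : ∀ {x y} z → x + z ≲ y + z → x ≲ y
+-cancelʳ {x} {y} z ⟨ h ⟩ = ⟨ (λ ε 0<ε → ev-map
  (λ n p → subst₂ ℚ._≤_ (solve 2 (λ x z → (x :+ z) :- z := x) refl (seq x n) (seq z n))
                        (solve 3 (λ y z e → (y :+ z :+ e) :- z := y :+ e) refl (seq y n) (seq z n) ε)
                        (ℚ.+-monoˡ-≤ (ℚ.- seq z n) p))
  (h ε 0<ε)) ⟩

≲-ε : ∀ {x y} → (∀ ε → 0ℚ ℚ.< ε → x ≲ y + fromℚ ε) → x ≲ y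
≲-ε {x} {y} h = ⟨ (λ ε 0<ε → ev-map
  (λ n → subst (seq x n ℚ.≤_) (trans (ℚ.+-assoc (seq y n) _ _) (cong (seq y n ℚ.+_) (½+½ ε))))
  (un≲ (h _ (0<½ε 0<ε)) _ (0<½ε 0<ε))) ⟩

fromℚ-mono : ∀ {p q} → p ℚ.≤ q → fromℚ p ≲ fromℚ q
fromℚ-mono h = eventually⇒≲ (0 , λ _ _ → h)

fromℚ-½+½ : ∀ ε → fromℚ (½ ℚ.* ε) + fromℚ (½ ℚ.* ε) ≅ fromℚ ε
fromℚ-½+½ ε = pointwise⇒≅ (λ _ → ½+½ ε)

fromℚ≲⇒0< : ∀ {c x} → 0ℚ ℚ.< c → fromℚ c ≲ x → 0ℝ < x
fromℚ≲⇒0< {c} {x} 0<c ⟨ h ⟩ = ½ ℚ.* c , 0<½ε 0<c , ev-map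
  (λ n p → subst₂ ℚ._≤_
    (trans (cong (ℚ._- (½ ℚ.* c)) (sym (½+½ c))) (solve 1 (λ e → (e :+ e) :- e := con 0ℚ :+ e) refl (½ ℚ.* c)))
    (solve 2 (λ x e → (x :+ e) :- e := x) refl (seq x n) (½ ℚ.* c))
    (ℚ.+-monoˡ-≤ (ℚ.- (½ ℚ.* c)) p))
  (h _ (0<½ε 0<c))

-- If a, b ≥ -η and a ≤ A, b ≤ B then (a + η)(b + η) ≥ 0 gives ab ≥ -η(A + B + η).
*-nonneg : ∀ {x y} → 0ℝ ≲ x → 0ℝ ≲ y → 0ℝ ≲ x * y
*-nonneg {x} {y} ⟨ 0≤x ⟩ ⟨ 0≤y ⟩ = ⟨ go ⟩
  where
  go : 0ℝ ≤ x * y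
  go ε 0<ε
    with eventually-bounded (seq x) (cauchy x) | eventually-bounded (seq y) (cauchy y)
  ... | A , 0<A , bx | B , 0<B , by
    with divide (A ℚ.+ B ℚ.+ 1ℚ) ε (+-pos (+-pos 0<A 0<B) 0<1) 0<ε
  ... | δ , 0<δ , eq = ev-map₂ core
          (ev-map₂ (λ n p q → p , q) bx (0≤x η 0<η)) (ev-map₂ (λ n p q → p , q) by (0≤y η 0<η))
    where
    η : ℚ
    η = δ ℚ.⊓ 1ℚ
    0<η : 0ℚ ℚ.< η
    0<η with ℚ.⊓-sel δ 1ℚ
    ... | inj₁ e = subst (0ℚ ℚ.<_) (sym e) 0<δ
    ... | inj₂ e = subst (0ℚ ℚ.<_) (sym e) 0<1
    core : ∀ n → ∣ seq x n ∣ ℚ.≤ A × 0ℚ ℚ.≤ seq x n ℚ.+ η → ∣ seq y n ∣ ℚ.≤ B × 0ℚ ℚ.≤ seq y n ℚ.+ η →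
           0ℚ ℚ.≤ seq x n ℚ.* seq y n ℚ.+ ε
    core n (∣a∣≤A , 0≤a+η) (∣b∣≤B , 0≤b+η) = begin
        0ℚ                                          ≤⟨ 0≤p*q 0≤a+η 0≤b+η ⟩
        (a ℚ.+ η) ℚ.* (b ℚ.+ η)                     ≡⟨ expand a b η ⟩
        a ℚ.* b ℚ.+ (b ℚ.+ a ℚ.+ η) ℚ.* η           ≤⟨ ℚ.+-monoʳ-≤ (a ℚ.* b) tail ⟩
        a ℚ.* b ℚ.+ (A ℚ.+ B ℚ.+ 1ℚ) ℚ.* δ          ≡⟨ cong (a ℚ.* b ℚ.+_) eq ⟩
        a ℚ.* b ℚ.+ ε                               ∎
      where
      open ℚ.≤-Reasoning
      a b : ℚ
      a = seq x n
      b = seq y n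
      expand : ∀ a b e → (a ℚ.+ e) ℚ.* (b ℚ.+ e) ≡ a ℚ.* b ℚ.+ (b ℚ.+ a ℚ.+ e) ℚ.* e
      expand = solve 3 (λ a b e → (a :+ e) :* (b :+ e) := a :* b :+ (b :+ a :+ e) :* e) refl
      tail : (b ℚ.+ a ℚ.+ η) ℚ.* η ℚ.≤ (A ℚ.+ B ℚ.+ 1ℚ) ℚ.* δ
      tail = ℚ.≤-trans
        (ℚ.*-monoʳ-≤-nonNeg η {{ℚ.nonNegative (ℚ.<⇒≤ 0<η)}}
          (ℚ.+-mono-≤ (subst (ℚ._≤ A ℚ.+ B) (ℚ.+-comm a b)
                        (ℚ.+-mono-≤ (ℚ.≤-trans (p≤∣p∣ a) ∣a∣≤A) (ℚ.≤-trans (p≤∣p∣ b) ∣b∣≤B)))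
                      (ℚ.p⊓q≤q δ 1ℚ)))
        (ℚ.*-monoˡ-≤-nonNeg (A ℚ.+ B ℚ.+ 1ℚ) {{ℚ.nonNegative (ℚ.<⇒≤ (+-pos (+-pos 0<A 0<B) 0<1))}}
          (ℚ.p⊓q≤p δ 1ℚ))

*-monoʳ : ∀ {x y} z → 0ℝ ≲ z → x ≲ y → x * z ≲ y * z
*-monoʳ {x} {y} z 0≤z ⟨ x≤y ⟩ = ⟨ (λ ε 0<ε → ev-map
  (λ n p → subst₂ ℚ._≤_ (ℚ.+-identityˡ _)
    (solve 4 (λ x y z e → (y :- x) :* z :+ e :+ x :* z := y :* z :+ e) refl (seq x n) (seq y n) (seq z n) ε)
    (ℚ.+-monoˡ-≤ (seq x n ℚ.* seq z n) p))
  (un≲ (*-nonneg {y - x} {z} ⟨ 0≤y-x ⟩ 0≤z) ε 0<ε)) ⟩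
  where
  0≤y-x : 0ℝ ≤ y - x
  0≤y-x δ 0<δ = ev-map
    (λ n p → subst₂ ℚ._≤_ (ℚ.+-inverseʳ (seq x n))
      (solve 3 (λ x y e → (y :+ e) :- x := (y :- x) :+ e) refl (seq x n) (seq y n) δ)
      (ℚ.+-monoˡ-≤ (ℚ.- seq x n) p))
    (x≤y δ 0<δ)

*-comm : ∀ x y → x * y ≅ y * x
*-comm x y = pointwise⇒≅ (λ n → ℚ.*-comm (seq x n) (seq y n))

*-monoˡ : ∀ {x y} z → 0ℝ ≲ z → x ≲ y → z * x ≲ z * y
*-monoˡ {x} {y} z 0≤z x≤y =
  ≲-trans (≅⇒≲ (*-comm z x)) (≲-trans (*-monoʳ z 0≤z x≤y) (≅⇒≲ (*-comm y z)))

-- Measure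

partialSum-stable : ∀ {a} n → (∀ i → n ℕ.≤ i → a i ≅ 0ℝ) → ∀ j → partialSum a (j ℕ.+ n) ≅ partialSum a n
partialSum-stable n h zero = ≅-refl
partialSum-stable n h (suc j) =
  ≅-trans (+-cong (partialSum-stable n h j) (h (j ℕ.+ n) (ℕ.m≤n+m n j))) (+-identityʳ _)

HasSum-finite : ∀ {a s} n → HasSum a s → (∀ i → n ℕ.≤ i → a i ≅ 0ℝ) → s ≅ partialSum a n
HasSum-finite {a} {s} n a→s h =
  ≲-ε (λ ε 0<ε → let N , g = a→s ε 0<ε in
    ≲-trans ⟨ proj₂ (g (N ℕ.+ n) (ℕ.m≤m+n N n)) ⟩ (+-mono (≅⇒≲ (partialSum-stable n h N)) ≲-refl)) &
  ≲-ε (λ ε 0<ε → let N , g = a→s ε 0<ε in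
    ≲-trans (≅⇒≳ (partialSum-stable n h N)) ⟨ proj₁ (g (N ℕ.+ n) (ℕ.m≤m+n N n)) ⟩)

-- Consecutive partial sums differ by `x` and both come arbitrarily close to `s`. Applied to a
-- sequence of empty sets this gives `μ-∅`, on which finite additivity rests, since
-- `BorelProbability` states only σ-additivity.
HasSum-const : ∀ {x s} → 0ℝ ≲ x → HasSum (λ _ → x) s → x ≅ 0ℝ
HasSum-const {x} {s} 0≤x h = ≲-ε x≲ε & 0≤x
  where
  x≲ε : ∀ ε → 0ℚ ℚ.< ε → x ≲ 0ℝ + fromℚ ε
  x≲ε ε 0<ε with h (½ ℚ.* ε) (0<½ε 0<ε)
  ... | N , g = +-cancelʳ (partialSum (λ _ → x) N) (begin
      x + S                                               ≈⟨ +-comm x S ⟩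
      S + x                                               ≤⟨ ⟨ proj₁ (g (suc N) (ℕ.n≤1+n N)) ⟩ ⟩
      s + fromℚ (½ ℚ.* ε)                                 ≤⟨ +-mono ⟨ proj₂ (g N ℕ.≤-refl) ⟩ ≲-refl ⟩
      (S + fromℚ (½ ℚ.* ε)) + fromℚ (½ ℚ.* ε)             ≈⟨ +-assoc S _ _ ⟩
      S + (fromℚ (½ ℚ.* ε) + fromℚ (½ ℚ.* ε))             ≈⟨ +-cong ≅-refl (fromℚ-½+½ ε) ⟩
      S + fromℚ ε                                         ≈⟨ +-comm S _ ⟩
      fromℚ ε + S                                         ≈⟨ +-cong (≅-sym (+-identityˡ (fromℚ ε))) ≅-refl ⟩
      (0ℝ + fromℚ ε) + S                                  ∎)
    where
    open ≲-Reasoning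
    S : ℝ
    S = partialSum (λ _ → x) N

↾-suc : ∀ {A : Set} (x : Seq A) n → x ↾ suc n ≡ (x ↾ n) ∷ʳ x n
↾-suc x n = sym (List.applyUpTo-∷ʳ x n)

↾-prefix : ∀ {A : Set} {x y : Seq A} n → x ↾ suc n ≡ y ↾ suc n → x ↾ n ≡ y ↾ n
↾-prefix {x = x} {y} n eq =
  List.∷ʳ-injectiveˡ (x ↾ n) (y ↾ n) (trans (sym (↾-suc x n)) (trans eq (↾-suc y n)))

length-∷ʳ : ∀ {A : Set} (σ : List A) i → length (σ ∷ʳ i) ≡ suc (length σ)
length-∷ʳ σ i = trans (List.length-++ σ) (ℕ.+-comm (length σ) 1)

⊏-∷ʳ⁻ : ∀ {A : Set} {σ : List A} {i x} → σ ∷ʳ i ⊏ x → σ ⊏ x × x (length σ) ≡ i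
⊏-∷ʳ⁻ {σ = σ} {i} {x} h =
  List.∷ʳ-injective (x ↾ length σ) σ
    (trans (sym (↾-suc x (length σ))) (trans (cong (x ↾_) (sym (length-∷ʳ σ i))) h))

⊏-∷ʳ⁺ : ∀ {A : Set} {σ : List A} {i x} → σ ⊏ x → x (length σ) ≡ i → σ ∷ʳ i ⊏ x
⊏-∷ʳ⁺ {σ = σ} {i} {x} h eq =
  trans (cong (x ↾_) (length-∷ʳ σ i)) (trans (↾-suc x (length σ)) (cong₂ _∷ʳ_ h eq))

module _ {ℓ : Level} {A : Set} where

  depends-on-prefix⇒Open : ∀ {V : Pred (Seq A) ℓ} n → (∀ x y → y ↾ n ≡ x ↾ n → x ∈ V → y ∈ V) → Open V
  depends-on-prefix⇒Open n h x x∈V = n , λ y eq → h x y eq x∈V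

  Borel-I : ∀ σ → Borel {ℓ} {A} (I σ)
  Borel-I σ = open-set (depends-on-prefix⇒Open (length σ) λ x y eq (lift h) → lift (trans eq h))

  Borel-∅ : Borel {ℓ} {A} ∅
  Borel-∅ = open-set λ _ ()

  _then_ : Pred (Seq A) ℓ → Pred (Seq A) ℓ → ℕ → Pred (Seq A) ℓ
  (B then C) 0             = B
  (B then C) 1             = C
  (B then C) (suc (suc _)) = ∅

  Borel-then : ∀ {B C} → Borel B → Borel C → ∀ i → Borel ((B then C) i)
  Borel-then b c 0             = b
  Borel-then b c 1             = c
  Borel-then b c (suc (suc _)) = Borel-∅

  ∪≐⋃-then : ∀ {B C : Pred (Seq A) ℓ} → B ∪ C ≐ ⋃ ℕ (B then C)
  ∪≐⋃-then = (λ { (inj₁ b) → 0 , b ; (inj₂ c) → 1 , c })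
           , (λ { (0 , b) → inj₁ b ; (1 , c) → inj₂ c ; (suc (suc _) , ()) })

  ≐-sym : {B C : Pred (Seq A) ℓ} → B ≐ C → C ≐ B
  ≐-sym (f , g) = g , f

  Borel-∪ : {B C : Pred (Seq A) ℓ} → Borel B → Borel C → Borel (B ∪ C)
  Borel-∪ {B} {C} b c = resp-≐ (≐-sym (∪≐⋃-then {B} {C})) (union (Borel-then b c))

  module _ (em : ExcludedMiddle ℓ) where

    Borel-∩ : {B C : Pred (Seq A) ℓ} → Borel B → Borel C → Borel (B ∩ C)
    Borel-∩ b c = resp-≐
      ( (λ h → em⇒dne em (λ ¬b → h (inj₁ ¬b)) , em⇒dne em (λ ¬c → h (inj₂ ¬c)))
      , (λ (x∈B , x∈C) → λ { (inj₁ ¬b) → ¬b x∈B ; (inj₂ ¬c) → ¬c x∈C }))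
      (complement (Borel-∪ (complement b) (complement c)))

    Borel-∖ : {B C : Pred (Seq A) ℓ} → Borel B → Borel C → Borel (B ∖ C)
    Borel-∖ b c = Borel-∩ b (complement c)

    Borel-⋂ : {B : ℕ → Pred (Seq A) ℓ} → (∀ i → Borel (B i)) → Borel (⋂ ℕ B)
    Borel-⋂ b = resp-≐ ((λ h i → em⇒dne em (λ ¬b → h (i , ¬b))) , (λ h (i , ¬b) → ¬b (h i)))
      (complement (union (λ i → complement (b i))))

module _ {ℓ : Level} {A : Set} (em : ExcludedMiddle ℓ) (m : BorelProbability ℓ A) where

  μ-≅ : ∀ {B C} → Borel B → Borel C → B ≐ C → μ m B ≅ μ m C
  μ-≅ b c h = ≈⇒≅ (μ-cong m b c h)

  μ-∅ : μ m ∅ ≅ 0ℝ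
  μ-∅ = HasSum-const {s = μ m (⋃ ℕ (λ _ → ∅))} ⟨ μ-nonneg m Borel-∅ ⟩
    (σ-additive m (λ _ → ∅) (λ _ → Borel-∅) (λ { _ _ _ (_ , () , _) }))

  μ-empty : ∀ {B} → Borel B → (∀ x → x ∉ B) → μ m B ≅ 0ℝ
  μ-empty b h = ≅-trans (μ-≅ b Borel-∅ ((λ {x} x∈B → ⊥-elim (h x x∈B)) , λ ())) μ-∅

  μ-partition : ∀ {X} {B : ℕ → Pred (Seq A) ℓ} n → Borel X → (∀ i → Borel (B i)) → X ≐ ⋃ ℕ B →
                (∀ i j → i ≢ j → ¬ (B i ≬ B j)) → (∀ i → n ℕ.≤ i → ∀ x → x ∉ B i) →
                μ m X ≅ partialSum (λ i → μ m (B i)) n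
  μ-partition {X} {B} n bX b X≐ disj empty = ≅-trans (μ-≅ bX (union b) X≐)
    (HasSum-finite n (σ-additive m B b disj) (λ i n≤i → μ-empty (b i) (empty i n≤i)))

  μ-∪ : ∀ {X B C} → Borel X → Borel B → Borel C → X ≐ B ∪ C → ¬ (B ≬ C) → μ m X ≅ μ m B + μ m C
  μ-∪ {X} {B} {C} bX b c (f , g) disj = ≅-trans
    (μ-partition {X} {B then C} 2 bX (Borel-then b c)
      ((λ x∈X → proj₁ (∪≐⋃-then {B = B} {C}) (f x∈X)) , (λ u → g (proj₂ (∪≐⋃-then {B = B} {C}) u)))
      disjoint
      (λ { (suc (suc _)) _ _ () ; zero () ; (suc zero) (ℕ.s≤s ()) }))
    (+-cong (+-identityˡ _) ≅-refl)
    where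
    disjoint : ∀ i j → i ≢ j → ¬ ((B then C) i ≬ (B then C) j)
    disjoint 0 0 i≢j _ = i≢j refl
    disjoint 0 1 _ h = disj h
    disjoint 1 0 _ (x , x∈C , x∈B) = disj (x , x∈B , x∈C)
    disjoint 1 1 i≢j _ = i≢j refl
    disjoint (suc (suc _)) _ _ (_ , () , _)
    disjoint 0 (suc (suc _)) _ (_ , _ , ())
    disjoint 1 (suc (suc _)) _ (_ , _ , ())

  μ-∖ : ∀ {B C} → Borel B → Borel C → C ⊆ B → μ m B ≅ μ m C + μ m (B ∖ C)
  μ-∖ {B} {C} b c C⊆B = μ-∪ b c (Borel-∖ em b c) (split , join) (λ (x , x∈C , _ , x∉C) → x∉C x∈C)
    where
    split : B ⊆ C ∪ (B ∖ C)
    split {x} x∈B with em {x ∈ C}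
    ... | yes x∈C = inj₁ x∈C
    ... | no  x∉C = inj₂ (x∈B , x∉C)
    join : C ∪ (B ∖ C) ⊆ B
    join (inj₁ x∈C)       = C⊆B x∈C
    join (inj₂ (x∈B , _)) = x∈B

  μ-mono : ∀ {B C} → Borel B → Borel C → C ⊆ B → μ m C ≲ μ m B
  μ-mono {B} {C} b c C⊆B = begin
    μ m C                  ≈⟨ +-identityʳ _ ⟨
    μ m C + 0ℝ             ≤⟨ +-mono ≲-refl ⟨ μ-nonneg m (Borel-∖ em b c) ⟩ ⟩
    μ m C + μ m (B ∖ C)    ≈⟨ μ-∖ b c C⊆B ⟨
    μ m B                  ∎
    where open ≲-Reasoning

  decreasing : {D : ℕ → Pred (Seq A) ℓ} → (∀ i → D (suc i) ⊆ D i) → ∀ {i j} → i ℕ.≤ j → D j ⊆ D i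
  decreasing {D} dec {i} i≤j = go (ℕ.≤⇒≤′ i≤j)
    where
    go : ∀ {j} → i ℕ.≤′ j → D j ⊆ D i
    go ℕ.≤′-refl        x∈D = x∈D
    go (ℕ.≤′-step i≤′j) x∈D = go i≤′j (dec _ x∈D)

  -- Continuity from above, put as a bound so that no limit of the measures has to be formed. What
  -- `D 0` loses on the way to the intersection is the disjoint union of the layers lost at each
  -- step; their partial sums telescope to the loss from `D 0` to `D n`.
  μ-⋂-≥ : ∀ {D : ℕ → Pred (Seq A) ℓ} {c} → (∀ i → Borel (D i)) → (∀ i → D (suc i) ⊆ D i) →
          (∀ i → c ≲ μ m (D i)) → c ≲ μ m (⋂ ℕ D)
  μ-⋂-≥ {D} {c} b dec c≲ = ≲-ε λ ε 0<ε → let n , μR₀≲Sₙ+ε = μR₀≲ ε 0<ε in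
    +-cancelʳ (μ m R₀) (begin
      c + μ m R₀                                    ≈⟨ +-comm c _ ⟩
      μ m R₀ + c                                    ≤⟨ +-mono μR₀≲Sₙ+ε (c≲ n) ⟩
      (S n + fromℚ ε) + μ m (D n)                   ≈⟨ swap (S n) (fromℚ ε) (μ m (D n)) ⟩
      (S n + μ m (D n)) + fromℚ ε                   ≈⟨ +-cong (telescope n) ≅-refl ⟩
      μ m (D 0) + fromℚ ε                           ≈⟨ +-cong (μ-∖ (b 0) b∞ (λ h → h 0)) ≅-refl ⟩
      (μ m (⋂ ℕ D) + μ m R₀) + fromℚ ε              ≈⟨ swap (μ m (⋂ ℕ D)) (μ m R₀) (fromℚ ε) ⟩
      (μ m (⋂ ℕ D) + fromℚ ε) + μ m R₀              ∎)
    where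
    open ≲-Reasoning
    swap : ∀ x y z → (x + y) + z ≅ (x + z) + y
    swap x y z = ≅-trans (+-assoc x y z) (≅-trans (+-cong ≅-refl (+-comm y z)) (≅-sym (+-assoc x z y)))
    b∞ : Borel (⋂ ℕ D)
    b∞ = Borel-⋂ em b
    layer : ℕ → Pred (Seq A) ℓ
    layer i = D i ∖ D (suc i)
    bl : ∀ i → Borel (layer i)
    bl i = Borel-∖ em (b i) (b (suc i))
    S : ℕ → ℝ
    S = partialSum (λ i → μ m (layer i))
    R₀ : Pred (Seq A) ℓ
    R₀ = D 0 ∖ ⋂ ℕ D
    telescope : ∀ n → S n + μ m (D n) ≅ μ m (D 0)
    telescope zero    = +-identityˡ _
    telescope (suc n) = ≅-trans (+-assoc _ _ _) (≅-trans (+-cong ≅-refl (≅-trans (+-comm _ _)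
      (≅-sym (μ-∖ (b n) (b (suc n)) (dec n))))) (telescope n))
    leaves : ∀ {x} n → x ∈ D 0 → x ∉ D n → x ∈ ⋃ ℕ layer
    leaves zero x∈D₀ x∉D₀ = contradiction x∈D₀ x∉D₀
    leaves {x} (suc n) x∈D₀ x∉Dₙ₊₁ with em {x ∈ D n}
    ... | yes x∈Dₙ = n , x∈Dₙ , x∉Dₙ₊₁
    ... | no  x∉Dₙ = leaves n x∈D₀ x∉Dₙ
    R₀≐ : ⋃ ℕ layer ≐ R₀
    R₀≐ = (λ (i , x∈Dᵢ , x∉) → decreasing {D} dec ℕ.z≤n x∈Dᵢ , λ h → x∉ (h (suc i)))
        , (λ {x} (x∈D₀ , x∉) → em⇒dne em λ ¬u → x∉ λ n → em⇒dne em λ x∉Dₙ → ¬u (leaves n x∈D₀ x∉Dₙ))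
    disjoint : ∀ i j → i ≢ j → ¬ (layer i ≬ layer j)
    disjoint i j i≢j (x , (x∈Dᵢ , x∉Dᵢ₊₁) , (x∈Dⱼ , x∉Dⱼ₊₁)) with ℕ.<-cmp i j
    ... | tri< i<j _ _ = x∉Dᵢ₊₁ (decreasing {D} dec i<j x∈Dⱼ)
    ... | tri≈ _ i≡j _ = i≢j i≡j
    ... | tri> _ _ j<i = x∉Dⱼ₊₁ (decreasing {D} dec j<i x∈Dᵢ)
    μR₀≲ : ∀ ε → 0ℚ ℚ.< ε → ∃[ n ] μ m R₀ ≲ S n + fromℚ ε
    μR₀≲ ε 0<ε = let N , g = σ-additive m layer bl disjoint ε 0<ε in
      N , ≲-trans (≅⇒≳ (μ-≅ (union bl) (Borel-∖ em (b 0) b∞) R₀≐)) ⟨ proj₂ (g N ℕ.≤-refl) ⟩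

module _ {ℓ : Level} {k : ℕ} (em : ExcludedMiddle ℓ) (m : BorelProbability ℓ (Fin k))
         {X : Pred (Seq (Fin k)) ℓ} (bX : Borel X) where

  -- Indexed by all natural numbers, and empty from `k` on, so that the children of a cylinder form
  -- a sequence to which σ-additivity applies.
  child : List (Fin k) → ℕ → Pred (Seq (Fin k)) ℓ
  child τ i x = x ∈ X × x ∈ I {ℓ} τ × Lift ℓ (toℕ (x (length τ)) ≡ i)

  child-Borel : ∀ τ i → Borel (child τ i)
  child-Borel τ i = Borel-∩ em bX (open-set (depends-on-prefix⇒Open (suc (length τ))
    λ { x y eq (lift h , lift h′) → lift (trans (↾-prefix {x = y} {x} (length τ) eq) h) ,
        lift (trans (cong toℕ (last x y (length τ) eq)) h′) }))
    where
    last : ∀ (x y : Seq (Fin k)) n → y ↾ suc n ≡ x ↾ suc n → y n ≡ x n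
    last x y n eq = List.∷ʳ-injectiveʳ (y ↾ n) (x ↾ n) (trans (sym (↾-suc y n)) (trans eq (↾-suc x n)))

  μ-child : ∀ τ j → μ m (child τ (toℕ j)) ≅ μ m (X ∩ I (τ ∷ʳ j))
  μ-child τ j = μ-≅ em m (child-Borel τ (toℕ j)) (Borel-∩ em bX (Borel-I (τ ∷ʳ j)))
    ( (λ { (x∈X , lift h , lift eq) → x∈X , lift (⊏-∷ʳ⁺ {σ = τ} h (Fin.toℕ-injective eq)) })
    , (λ { {x} (x∈X , lift h) → let h′ , eq = ⊏-∷ʳ⁻ {σ = τ} {x = x} h in x∈X , lift h′ , lift (cong toℕ eq) }))

  μ-children : ∀ τ → μ m (X ∩ I τ) ≅ partialSum (λ i → μ m (child τ i)) k
  μ-children τ = μ-partition em m {B = child τ} k (Borel-∩ em bX (Borel-I τ)) (child-Borel τ)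
    ( (λ {x} (x∈X , h) → toℕ (x (length τ)) , x∈X , h , lift refl)
    , (λ (_ , x∈X , h , _) → x∈X , h))
    (λ { i j i≢j (x , (_ , _ , lift p) , (_ , _ , lift q)) → i≢j (trans (sym p) q) })
    (λ { i k≤i x (_ , _ , lift p) → ℕ.<⇒≱ (Fin.toℕ<n (x (length τ))) (subst (k ℕ.≤_) (sym p) k≤i) })

-- Trees and codes

≺-irrefl : ∀ σ → ¬ (σ ≺ σ)
≺-irrefl σ (inj₁ h)       = ℕ.n≮n _ h
≺-irrefl σ (inj₂ (_ , h)) = <-irreflexive Fin.<-irrefl (≡⇒Pointwise-≡ refl) h

≺-trans : ∀ {ρ σ τ} → ρ ≺ σ → σ ≺ τ → ρ ≺ τ
≺-trans (inj₁ p)       (inj₁ q)       = inj₁ (ℕ.<-trans p q)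
≺-trans (inj₁ p)       (inj₂ (e , _)) = inj₁ (subst (_ ℕ.<_) e p)
≺-trans (inj₂ (e , _)) (inj₁ q)       = inj₁ (subst (ℕ._< _) (sym e) q)
≺-trans (inj₂ (e , p)) (inj₂ (f , q)) =
  inj₂ (trans e f , <-transitive isEquivalence (resp₂ Fin._<_) Fin.<-trans p q)

≺-∷ʳ : ∀ σ i → σ ≺ σ ∷ʳ i
≺-∷ʳ σ i = inj₁ (ℕ.≤-reflexive (sym (length-∷ʳ σ i)))

Lex-∷ʳ-mono : ∀ {σ τ : List (Fin 2)} i j → length σ ≡ length τ →
              Lex-< _≡_ Fin._<_ σ τ → Lex-< _≡_ Fin._<_ (σ ∷ʳ i) (τ ∷ʳ j)
Lex-∷ʳ-mono {[]}    {[]}    i j _ (base ())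
Lex-∷ʳ-mono {_ ∷ _} {_ ∷ _} i j _ (this p)   = this p
Lex-∷ʳ-mono {_ ∷ _} {_ ∷ _} i j e (next p h) = next p (Lex-∷ʳ-mono i j (ℕ.suc-injective e) h)

∷ʳ-mono-≺ : ∀ {σ τ} i j → σ ≺ τ → σ ∷ʳ i ≺ τ ∷ʳ j
∷ʳ-mono-≺ {σ} {τ} i j (inj₁ h) =
  inj₁ (subst₂ ℕ._<_ (sym (length-∷ʳ σ i)) (sym (length-∷ʳ τ j)) (ℕ.s≤s h))
∷ʳ-mono-≺ {σ} {τ} i j (inj₂ (e , h)) =
  inj₂ (trans (length-∷ʳ σ i) (trans (cong suc e) (sym (length-∷ʳ τ j))) , Lex-∷ʳ-mono i j e h)

siblings-≺ : ∀ σ → σ ∷ʳ 0F ≺ σ ∷ʳ 1F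
siblings-≺ σ = inj₂ (trans (length-∷ʳ σ 0F) (sym (length-∷ʳ σ 1F)) , go σ)
  where
  go : ∀ σ → Lex-< _≡_ Fin._<_ (σ ∷ʳ 0F) (σ ∷ʳ 1F)
  go []      = this (ℕ.s≤s ℕ.z≤n)
  go (_ ∷ σ) = next refl (go σ)

[]⊎∷ʳ : ∀ {A : Set} (σ : List A) → σ ≡ [] ⊎ ∃[ ρ ] ∃[ i ] σ ≡ ρ ∷ʳ i
[]⊎∷ʳ σ with initLast σ
... | []      = inj₁ refl
... | ρ ∷ʳ′ i = inj₂ (ρ , i , refl)

ParentClosed : Pred (List (Fin 2)) 0ℓ → Set
ParentClosed P = ∀ σ i → σ ∷ʳ i ∈ P → σ ∈ P

ParentClosed⇒IsTree : ∀ {P} → ParentClosed P → IsTree P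
ParentClosed⇒IsTree {P} pc σ []      h = subst P (List.++-identityʳ σ) h
ParentClosed⇒IsTree {P} pc σ (i ∷ τ) h =
  pc σ i (ParentClosed⇒IsTree {P} pc (σ ∷ʳ i) τ (subst P (sym (List.++-assoc σ [ i ] τ)) h))

-- Kőnig's lemma

infixr 6 _++ˢ_
_++ˢ_ : {A : Set} → List A → Seq A → Seq A
([] ++ˢ y) n            = y n
((a ∷ σ) ++ˢ y) zero    = a
((a ∷ σ) ++ˢ y) (suc n) = (σ ++ˢ y) n

++ˢ-↾ : {A : Set} (σ : List A) (y : Seq A) (n : ℕ) → σ ++ˢ y ↾ length σ ℕ.+ n ≡ σ ++ (y ↾ n)
++ˢ-↾ []      y n = refl
++ˢ-↾ (a ∷ σ) y n = cong (a ∷_) (++ˢ-↾ σ y n)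

ParentClosed-↾ : ∀ {P} → ParentClosed P → ∀ y k n → y ↾ k ℕ.+ n ∈ P → y ↾ n ∈ P
ParentClosed-↾ pc y zero    n h = h
ParentClosed-↾ {P} pc y (suc k) n h =
  ParentClosed-↾ {P} pc y k n (pc _ (y (k ℕ.+ n)) (subst P (↾-suc y (k ℕ.+ n)) h))

-- Arbitrarily long extensions stand in for infinitely many: in a binary tree the two agree, and
-- lengths spare the counting.
Unbounded : Pred (List (Fin 2)) 0ℓ → Pred (List (Fin 2)) 0ℓ
Unbounded P σ = ∀ N → ∃[ τ ] (σ ++ τ ∈ P × N ℕ.≤ length τ)

module _ (em : ExcludedMiddle 0ℓ) {P : Pred (List (Fin 2)) 0ℓ} (pc : ParentClosed P) where

  ¬Unbounded⇒bounded : ∀ {σ} → σ ∉ Unbounded P → ∃[ N ] ∀ τ → σ ++ τ ∈ P → ¬ (N ℕ.≤ length τ)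
  ¬Unbounded⇒bounded h = em⇒dne em λ none → h λ N → em⇒dne em λ ¬τ → none (N , λ τ p N≤ → ¬τ (τ , p , N≤))

  Unbounded-child : ∀ {σ} → σ ∈ Unbounded P → ∃[ i ] σ ∷ʳ i ∈ Unbounded P
  Unbounded-child {σ} u with em {σ ∷ʳ 0F ∈ Unbounded P} | em {σ ∷ʳ 1F ∈ Unbounded P}
  ... | yes u₀ | _      = 0F , u₀
  ... | no  _  | yes u₁ = 1F , u₁
  ... | no ¬u₀ | no ¬u₁ with ¬Unbounded⇒bounded ¬u₀ | ¬Unbounded⇒bounded ¬u₁
  -- One more than both bounds, as the first entry of the extension is spent on choosing the child.
  ...   | N₀ , b₀ | N₁ , b₁ with u (suc (N₀ ℕ.⊔ N₁))
  ...     | 0F ∷ τ , p , ℕ.s≤s N≤ =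
    contradiction (ℕ.m⊔n≤o⇒m≤o N₀ N₁ N≤) (b₀ τ (subst P (sym (List.++-assoc σ [ 0F ] τ)) p))
  ...     | 1F ∷ τ , p , ℕ.s≤s N≤ =
    contradiction (ℕ.m⊔n≤o⇒n≤o N₀ N₁ N≤) (b₁ τ (subst P (sym (List.++-assoc σ [ 1F ] τ)) p))

  kőnig : ∀ σ → σ ∈ Unbounded P → ∃[ y ] (σ ⊏ y × y ∈ Paths P)
  kőnig σ u = σ ++ˢ digit , prefix , λ n → ParentClosed-↾ pc (σ ++ˢ digit) (length σ) n (long n)
    where
    branch : ℕ → ∃[ ρ ] ρ ∈ Unbounded P
    branch zero    = σ , u
    branch (suc n) = let ρ , uρ = branch n ; i , uρi = Unbounded-child uρ in ρ ∷ʳ i , uρi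
    digit : Seq (Fin 2)
    digit n = proj₁ (Unbounded-child (proj₂ (branch n)))
    branch≡ : ∀ n → proj₁ (branch n) ≡ σ ++ (digit ↾ n)
    branch≡ zero    = sym (List.++-identityʳ σ)
    branch≡ (suc n) = trans (cong (_∷ʳ digit n) (branch≡ n))
      (trans (List.++-assoc σ (digit ↾ n) [ digit n ]) (cong (σ ++_) (sym (↾-suc digit n))))
    long : ∀ n → σ ++ˢ digit ↾ length σ ℕ.+ n ∈ P
    long n = subst P (trans (branch≡ n) (sym (++ˢ-↾ σ digit n)))
      (let τ , p , _ = proj₂ (branch n) 0 in ParentClosed⇒IsTree {P} pc _ τ p)
    prefix : σ ⊏ σ ++ˢ digit
    prefix = trans (cong (σ ++ˢ digit ↾_) (sym (ℕ.+-identityʳ (length σ))))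
      (trans (++ˢ-↾ σ digit 0) (List.++-identityʳ σ))

-- Decoding a code by breadth-first search

data Allows : Fin 3 → Fin 2 → Set where
  allow-0 : Allows 0F 0F
  allow-1 : Allows 1F 1F
  allow-2 : ∀ i → Allows 2F i

children : List (Fin 2) → Fin 3 → List (List (Fin 2))
children σ 0F = [ σ ∷ʳ 0F ]
children σ 1F = [ σ ∷ʳ 1F ]
children σ 2F = σ ∷ʳ 0F ∷ σ ∷ʳ 1F ∷ []

-- The value at `[]` is a mere default: every queue that arises is `Nonempty`.
headNode : List (List (Fin 2)) → List (Fin 2)
headNode []      = []
headNode (σ ∷ _) = σ

step : List (List (Fin 2)) → Fin 3 → List (List (Fin 2))
step q d = drop 1 q ++ children (headNode q) d

-- After `n` digits it holds, in order of discovery, the nodes found but not yet expanded; its front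
-- is the node that digit `n` describes.
queue : Seq (Fin 3) → ℕ → List (List (Fin 2))
queue x zero    = [ [] ]
queue x (suc n) = step (queue x n) (x n)

Nonempty : List (List (Fin 2)) → Set
Nonempty q = q ≡ headNode q ∷ drop 1 q

step-nonempty : ∀ q d → Nonempty (step q d)
step-nonempty q d with drop 1 q | d
... | _ ∷ _ | _  = refl
... | []    | 0F = refl
... | []    | 1F = refl
... | []    | 2F = refl

∈-children⁺ : ∀ {σ d i} → Allows d i → σ ∷ʳ i ∈ₗ children σ d
∈-children⁺ allow-0      = here refl
∈-children⁺ allow-1      = here refl
∈-children⁺ (allow-2 0F) = here refl
∈-children⁺ (allow-2 1F) = there (here refl)

∈-children⁻ : ∀ {σ τ} d → τ ∈ₗ children σ d → ∃[ i ] (Allows d i × τ ≡ σ ∷ʳ i)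
∈-children⁻ 0F (here refl)         = 0F , allow-0 , refl
∈-children⁻ 1F (here refl)         = 1F , allow-1 , refl
∈-children⁻ 2F (here refl)         = 0F , allow-2 0F , refl
∈-children⁻ 2F (there (here refl)) = 1F , allow-2 1F , refl

allowed : ∀ d → ∃[ i ] Allows d i
allowed 0F = 0F , allow-0
allowed 1F = 1F , allow-1
allowed 2F = 0F , allow-2 0F

module _ (x : Seq (Fin 3)) where

  visited : ℕ → List (Fin 2)
  visited n = headNode (queue x n)

  pending : ℕ → List (List (Fin 2))
  pending n = drop 1 (queue x n)

  queue≡ : ∀ n → Nonempty (queue x n)
  queue≡ zero = refl
  queue≡ (suc n) = step-nonempty (queue x n) (x n)

  visited∈queue : ∀ n → visited n ∈ₗ queue x n
  visited∈queue n = subst (visited n ∈ₗ_) (sym (queue≡ n)) (here refl)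

  visited-reaches : ∀ {τ} u v n → queue x n ≡ u ++ τ ∷ v → ∃[ m ] visited m ≡ τ
  visited-reaches []      v n eq = n , cong headNode eq
  visited-reaches {τ} (a ∷ u) v n eq = visited-reaches u (v ++ children (visited n) (x n)) (suc n)
    (trans (cong (_++ children (visited n) (x n)) (cong (drop 1) eq)) (List.++-assoc u (τ ∷ v) _))

  ∈-queue⇒visited : ∀ {τ n} → τ ∈ₗ queue x n → ∃[ m ] visited m ≡ τ
  ∈-queue⇒visited {n = n} h = let u , v , eq = ∈-∃++ h in visited-reaches u v n eq

  ∈-queue⇒child : ∀ {τ} n → τ ∈ₗ queue x n →
    τ ≡ [] ⊎ ∃[ k ] ∃[ i ] (k ℕ.< n × Allows (x k) i × τ ≡ visited k ∷ʳ i)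
  ∈-queue⇒child zero (here refl) = inj₁ refl
  ∈-queue⇒child {τ} (suc n) h with ∈-++⁻ (pending n) h
  ... | inj₂ c = let i , a , eq = ∈-children⁻ (x n) c in inj₂ (n , i , ℕ.≤-refl , a , eq)
  ... | inj₁ r with ∈-queue⇒child n (subst (τ ∈ₗ_) (sym (queue≡ n)) (there r))
  ...   | inj₁ eq                     = inj₁ eq
  ...   | inj₂ (k , i , k<n , a , eq) = inj₂ (k , i , ℕ.m<n⇒m<1+n k<n , a , eq)

  -- The second half is the invariant that carries the induction: whatever is pending precedes the
  -- children about to be appended, so the new queue is sorted again. Moving the invariant on to the
  -- next front needs `visited-step`, hence the mutual recursion.
  queue-sorted : ∀ n → AllPairs _≺_ (queue x n) × All (_≺ visited n ∷ʳ 0F) (pending n)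
  visited-first  : ∀ n → All (visited n ≺_) (queue x (suc n))

  children-sorted : ∀ σ d → AllPairs _≺_ (children σ d)
  children-sorted σ 0F = [] ∷ []
  children-sorted σ 1F = [] ∷ []
  children-sorted σ 2F = (siblings-≺ σ ∷ []) ∷ [] ∷ []

  children-All : ∀ {p} {P : Pred (List (Fin 2)) p} σ d → (∀ i → P (σ ∷ʳ i)) → All P (children σ d)
  children-All σ 0F f = f 0F ∷ []
  children-All σ 1F f = f 1F ∷ []
  children-All σ 2F f = f 0F ∷ f 1F ∷ []

  visited-first n = All.++⁺
    (AllPairs.head (subst (AllPairs _≺_) (queue≡ n) (proj₁ (queue-sorted n))))
    (children-All (visited n) (x n) (≺-∷ʳ (visited n)))

  visited-step : ∀ n → visited n ≺ visited (suc n)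
  visited-step n = All.lookup (visited-first n) (visited∈queue (suc n))

  queue-sorted zero = ([] ∷ []) , []
  queue-sorted (suc n) with queue-sorted n
  ... | sorted , below =
    AllPairs.++⁺ (AllPairs.tail (subst (AllPairs _≺_) (queue≡ n) sorted))
                 (children-sorted (visited n) (x n))
                 (All.map (λ τ≺ → children-All (visited n) (x n)
                   (λ { 0F → τ≺ ; 1F → ≺-trans τ≺ (siblings-≺ (visited n)) })) below)
    , All.drop⁺ 1 (All.++⁺
        (All.map (λ τ≺ → ≺-trans τ≺ (∷ʳ-mono-≺ 0F 0F (visited-step n))) below)
        (children-All (visited n) (x n) (λ i → ∷ʳ-mono-≺ i 0F (visited-step n))))

  visited-increasing : ∀ {m n} → m ℕ.< n → visited m ≺ visited n
  visited-increasing {m} m<n = go (ℕ.≤⇒≤′ m<n)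
    where
    go : ∀ {n} → suc m ℕ.≤′ n → visited m ≺ visited n
    go ℕ.≤′-refl          = visited-step m
    go (ℕ.≤′-step {n} le) = ≺-trans (go le) (visited-step n)

  visited-injective : ∀ {m n} → visited m ≡ visited n → m ≡ n
  visited-injective {m} {n} eq with ℕ.<-cmp m n
  ... | tri< m<n _ _ = ⊥-elim (≺-irrefl (visited n) (subst (_≺ visited n) eq (visited-increasing m<n)))
  ... | tri≈ _ m≡n _ = m≡n
  ... | tri> _ _ n<m = ⊥-elim (≺-irrefl (visited n) (subst (visited n ≺_) eq (visited-increasing n<m)))

  Decoded : Pred (List (Fin 2)) 0ℓ
  Decoded σ = ∃[ n ] visited n ≡ σ

  Decoded-child⁺ : ∀ {n i} → Allows (x n) i → visited n ∷ʳ i ∈ Decoded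
  Decoded-child⁺ {n} a = ∈-queue⇒visited {n = suc n} (∈-++⁺ʳ (pending n) (∈-children⁺ a))

  Decoded⇒child : ∀ {σ i} → σ ∷ʳ i ∈ Decoded → ∃[ k ] (visited k ≡ σ × Allows (x k) i)
  Decoded⇒child {σ} {i} (m , eq) with ∈-queue⇒child m (visited∈queue m)
  ... | inj₁ eq′ with σ | trans (sym eq) eq′
  ...   | []    | ()
  ...   | _ ∷ _ | ()
  Decoded⇒child {σ} {i} (m , eq) | inj₂ (k , j , _ , a , eq′) =
    let σ≡ , i≡j = List.∷ʳ-injective σ (visited k) (trans (sym eq) eq′) in
    k , sym σ≡ , subst (Allows (x k)) (sym i≡j) a

  -- `Decoded⇒child` only yields some time at which the parent is visited. No node is visited twice,
  -- so that time is `n` and the digit in question is `x n`.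
  Decoded-child⁻ : ∀ {n i} → visited n ∷ʳ i ∈ Decoded → Allows (x n) i
  Decoded-child⁻ h = let k , eq , a = Decoded⇒child h in
    subst (λ n → Allows (x n) _) (visited-injective eq) a

  Decoded-parent : ParentClosed Decoded
  Decoded-parent σ i h = let k , eq , _ = Decoded⇒child h in k , eq

  -- Every digit allows some child, so the decoded tree has no dead ends.
  Decoded-unbounded : ∀ {σ} → σ ∈ Decoded → σ ∈ Unbounded Decoded
  Decoded-unbounded {σ} h zero    = [] , subst Decoded (sym (List.++-identityʳ σ)) h , ℕ.z≤n
  Decoded-unbounded {σ} (n , refl) (suc N) with allowed (x n)
  ... | i , a with Decoded-unbounded (Decoded-child⁺ a) N
  ...   | τ , h , N≤ = i ∷ τ , subst Decoded (List.++-assoc σ [ i ] τ) h , ℕ.s≤s N≤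

  -- `u` is the part of the queue still to be expanded, `v` the part already long enough. Each step
  -- removes a node from `u` and appends its children, longer by one, to `v`, until `u` is used up.
  queue-grows : ∀ {N} u v n → queue x n ≡ u ++ v → All (λ τ → N ℕ.≤ length τ) u →
    All (λ τ → suc N ℕ.≤ length τ) v → ∃[ n′ ] All (λ τ → suc N ℕ.≤ length τ) (queue x n′)
  queue-grows []      v n eq _ hv = n , subst (All _) (sym eq) hv
  queue-grows {N} (a ∷ u) v n eq (ha ∷ hu) hv =
    queue-grows u (v ++ children (visited n) (x n)) (suc n)
      (trans (cong (_++ children (visited n) (x n)) (cong (drop 1) eq)) (List.++-assoc u v _)) hu
      (All.++⁺ hv (children-All (visited n) (x n) λ i → subst (suc N ℕ.≤_) (sym (length-∷ʳ (visited n) i))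
        (ℕ.s≤s (subst (λ σ → N ℕ.≤ length σ) (sym (cong headNode eq)) ha))))

  queue-long : ∀ N → ∃[ n ] All (λ τ → N ℕ.≤ length τ) (queue x n)
  queue-long zero    = 0 , ℕ.z≤n ∷ []
  queue-long (suc N) = let n , h = queue-long N in
    queue-grows (queue x n) [] n (sym (List.++-identityʳ _)) h []

-- Codes of the closed sets that meet the paths of a tree

Meets : Pred (List (Fin 2)) 0ℓ → ℕ → Pred (Seq (Fin 3)) 0ℓ
Meets T L x = ∃[ τ ] (τ ∈ₗ queue x L × τ ∈ T)

module _ (em : ExcludedMiddle 0ℓ) (x : Seq (Fin 3)) {T : Pred (List (Fin 2)) 0ℓ} (pc : ParentClosed T) where

  -- The witness is the set of paths through the decoded tree. Late queues contain only long nodes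
  -- (`queue-long`), so meeting `T` at all times gives arbitrarily long common nodes of `T` and the
  -- decoded tree, and Kőnig's lemma turns these into a common path.
  Meets⇒Codes : (∀ L → Meets T L x) → x ∈ Codes (_≬ Paths T)
  Meets⇒Codes meets = K , satisfiable , closed , hits , record
    { node = visited x
    ; enumerates = record
      { increasing = λ m n → visited-increasing x
      ; sound = λ n → extend (n , refl)
      ; complete = λ _ → Nodes⇒Decoded
      }
    ; both = λ n h₀ h₁ → ⇒2F (allows n h₀) (allows n h₁)
    ; only-1 = λ n h₀ h₁ → ⇒1F (λ a → h₀ (extend (Decoded-child⁺ x a))) (allows n h₁)
    ; only-0 = λ n h₀ h₁ → ⇒0F (allows n h₀) (λ a → h₁ (extend (Decoded-child⁺ x a)))
    }
    where
    K : Pred (Seq (Fin 2)) 0ℓ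
    K = Paths (Decoded x)
    extend : ∀ {σ} → σ ∈ Decoded x → σ ∈ Nodes K
    extend {σ} h = let y , σ⊏y , y∈K = kőnig em (Decoded-parent x) σ (Decoded-unbounded x h) in y , y∈K , σ⊏y
    Nodes⇒Decoded : ∀ {σ} → σ ∈ Nodes K → σ ∈ Decoded x
    Nodes⇒Decoded {σ} (y , y∈K , σ⊏y) = subst (Decoded x) σ⊏y (y∈K (length σ))
    satisfiable : ∃[ y ] y ∈ K
    satisfiable = let y , y∈K , _ = extend (0 , refl) in y , y∈K
    closed : Closed K
    closed y adherent n = let z , z∈K , eq = adherent n in subst (Decoded x) eq (z∈K n)
    both-pc : ParentClosed (Decoded x ∩ T)
    both-pc σ i (h , h′) = Decoded-parent x σ i h , pc σ i h′
    unbounded : [] ∈ Unbounded (Decoded x ∩ T)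
    unbounded N = let n , long = queue-long x N ; τ , τ∈q , τ∈T = meets n in
      τ , (∈-queue⇒visited x {n = n} τ∈q , τ∈T) , All.lookup long τ∈q
    hits : K ≬ Paths T
    hits = let y , _ , h = kőnig em both-pc [] unbounded in y , (λ n → proj₁ (h n)) , (λ n → proj₂ (h n))
    allows : ∀ n {i} → visited x n ∷ʳ i ∈ Nodes K → Allows (x n) i
    allows n h = Decoded-child⁻ x (Nodes⇒Decoded h)
    ⇒2F : ∀ {d} → Allows d 0F → Allows d 1F → d ≡ 2F
    ⇒2F (allow-2 _) (allow-2 _) = refl
    ⇒1F : ∀ {d} → ¬ Allows d 0F → Allows d 1F → d ≡ 1F
    ⇒1F _ allow-1     = refl
    ⇒1F h (allow-2 _) = contradiction (allow-2 0F) h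
    ⇒0F : ∀ {d} → Allows d 0F → ¬ Allows d 1F → d ≡ 0F
    ⇒0F allow-0     _ = refl
    ⇒0F (allow-2 _) h = contradiction (allow-2 1F) h

  -- A point `y` common to `K` and the paths of `T` always has a prefix in the queue: when that
  -- prefix comes to the front, the digit read there allows the next prefix, which is then appended.
  Codes⇒Meets : x ∈ Codes (_≬ Paths T) → ∀ L → Meets T L x
  Codes⇒Meets (K , _ , _ , (y , y∈K , y∈T) , c) L = let n , h = follows L in y ↾ n , h , y∈T n
    where
    open IsCode c
    open Enumerates enumerates

    root : [] ∈ Nodes K
    root = y , y∈K , refl

    node-parent : ParentClosed (Nodes K)
    node-parent σ i (z , z∈K , h) = z , z∈K , proj₁ (⊏-∷ʳ⁻ {σ = σ} {x = z} h)

    node-extends : ∀ {σ} → σ ∈ Nodes K → ∃[ i ] σ ∷ʳ i ∈ Nodes K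
    node-extends {σ} (z , z∈K , h) = z (length σ) , z , z∈K , ⊏-∷ʳ⁺ {σ = σ} {x = z} h refl

    Nodes⇒allows : ∀ n {i} → node n ∷ʳ i ∈ Nodes K → Allows (x n) i
    Nodes⇒allows n {i} h with em {node n ∷ʳ 0F ∈ Nodes K} | em {node n ∷ʳ 1F ∈ Nodes K}
    Nodes⇒allows n {i}  h | yes h₀ | yes h₁ = subst (λ d → Allows d i) (sym (both n h₀ h₁)) (allow-2 i)
    Nodes⇒allows n {0F} h | yes h₀ | no ¬h₁ = subst (λ d → Allows d 0F) (sym (only-0 n h₀ ¬h₁)) allow-0
    Nodes⇒allows n {1F} h | yes h₀ | no ¬h₁ = contradiction h ¬h₁
    Nodes⇒allows n {0F} h | no ¬h₀ | _      = contradiction h ¬h₀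
    Nodes⇒allows n {1F} h | no ¬h₀ | _      = subst (λ d → Allows d 1F) (sym (only-1 n ¬h₀ h)) allow-1

    allows⇒Nodes : ∀ n {i} → Allows (x n) i → node n ∷ʳ i ∈ Nodes K
    allows⇒Nodes n {i} a with em {node n ∷ʳ 0F ∈ Nodes K} | em {node n ∷ʳ 1F ∈ Nodes K}
    allows⇒Nodes n {0F} a | yes h₀ | _      = h₀
    allows⇒Nodes n {1F} a | _      | yes h₁ = h₁
    allows⇒Nodes n {0F} a | no ¬h₀ | yes h₁ with () ← subst (λ d → Allows d 0F) (only-1 n ¬h₀ h₁) a
    allows⇒Nodes n {1F} a | yes h₀ | no ¬h₁ with () ← subst (λ d → Allows d 1F) (only-0 n h₀ ¬h₁) a
    -- `IsCode` leaves the digit open when neither child is a node. This cannot happen: a point of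
    -- `K` through `node n` passes through one of the children.
    allows⇒Nodes n {i}  a | no ¬h₀ | no ¬h₁ with node-extends (sound n)
    ... | 0F , h₀ = contradiction h₀ ¬h₀
    ... | 1F , h₁ = contradiction h₁ ¬h₁

    node-reflects-≺ : ∀ {m n} → node m ≺ node n → m ℕ.< n
    node-reflects-≺ {m} {n} h with ℕ.<-cmp m n
    ... | tri< m<n _ _  = m<n
    ... | tri≈ _ refl _ = ⊥-elim (≺-irrefl _ h)
    ... | tri> _ _ n<m  = ⊥-elim (≺-irrefl _ (≺-trans h (increasing n m n<m)))

    -- Both sequences are ≺-increasing and agree below `n`, and the `n`-th term of each occurs
    -- somewhere in the other: it is the root, or its parent has an index below `n`, where both
    -- sequences carry the same digit. An occurrence below `n` would repeat a term; two occurrences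
    -- above `n` would put each of the two `n`-th terms strictly before the other.
    node≡ : ∀ n → node n ≡ visited x n
    node≡ = <-rec _ λ n rec → let ih = λ k k<n → rec {k} k<n in
      compare n ih (decoded n ih) (is-node n ih)
      where
      decoded : ∀ n → (∀ k → k ℕ.< n → node k ≡ visited x k) → node n ∈ Decoded x
      decoded n ih with []⊎∷ʳ (node n)
      ... | inj₁ eq = 0 , sym eq
      ... | inj₂ (ρ , i , eq) with complete ρ (node-parent ρ i (subst (Nodes K) eq (sound n)))
      ...   | k , refl = subst (Decoded x) (sym (trans eq (cong (_∷ʳ i) (ih k k<n))))
                (Decoded-child⁺ x (Nodes⇒allows k (subst (Nodes K) eq (sound n))))
        where
        k<n : k ℕ.< n
        k<n = node-reflects-≺ (subst (node k ≺_) (sym eq) (≺-∷ʳ (node k) i))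
      is-node : ∀ n → (∀ k → k ℕ.< n → node k ≡ visited x k) → visited x n ∈ Nodes K
      is-node n ih with ∈-queue⇒child x n (visited∈queue x n)
      ... | inj₁ eq = subst (Nodes K) (sym eq) root
      ... | inj₂ (k , i , k<n , a , eq) = subst (Nodes K)
        (trans (cong (_∷ʳ i) (ih k k<n)) (sym eq)) (allows⇒Nodes k a)
      compare : ∀ n → (∀ k → k ℕ.< n → node k ≡ visited x k) →
                node n ∈ Decoded x → visited x n ∈ Nodes K → node n ≡ visited x n
      compare n ih (j , eq) h with complete _ h
      ... | j′ , eq′ with ℕ.<-cmp j n | ℕ.<-cmp j′ n
      ...   | tri≈ _ refl _ | _             = sym eq
      ...   | _             | tri≈ _ refl _ = eq′
      ...   | tri< j<n _ _  | _             =
        ⊥-elim (≺-irrefl (node n) (subst (_≺ node n) (trans (ih j j<n) eq) (increasing j n j<n)))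
      ...   | _             | tri< j′<n _ _ =
        ⊥-elim (ℕ.<-irrefl (visited-injective x (trans (sym (ih j′ j′<n)) eq′)) j′<n)
      ...   | tri> _ _ n<j  | tri> _ _ n<j′ =
        ⊥-elim (≺-irrefl (node n) (≺-trans (subst (node n ≺_) eq′ (increasing n j′ n<j′))
                                           (subst (visited x n ≺_) eq (visited-increasing x n<j))))

    follows : ∀ L → ∃[ n ] y ↾ n ∈ₗ queue x L
    follows zero = 0 , here refl
    follows (suc L) with follows L
    ... | n , h with subst (y ↾ n ∈ₗ_) (queue≡ x L) h
    ...   | there h′ = n , ∈-++⁺ˡ h′
    ...   | here eq  = suc n , subst (_∈ₗ queue x (suc L)) (sym y↾≡)
              (∈-++⁺ʳ (pending x L) (∈-children⁺ (Nodes⇒allows L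
                (subst (Nodes K) (trans y↾≡ (cong (_∷ʳ y n) (sym (node≡ L))))
                  (y , y∈K , cong (y ↾_) (List.length-applyUpTo y (suc n)))))))
      where
      y↾≡ : y ↾ suc n ≡ visited x L ∷ʳ y n
      y↾≡ = trans (↾-suc y n) (cong (_∷ʳ y n) eq)

-- Lower bound for the capacity

em-lower : ExcludedMiddle (lsuc 0ℓ) → ExcludedMiddle 0ℓ
em-lower em = map′ lower lift em

nodes : List (Fin 3) → List (List (Fin 2))
nodes = foldl step [ [] ]

nodes-∷ʳ : ∀ τ d → nodes (τ ∷ʳ d) ≡ step (nodes τ) d
nodes-∷ʳ τ d = List.foldl-∷ʳ step [ [] ] d τ

nodes-nonempty : ∀ τ → Nonempty (nodes τ)
nodes-nonempty τ = go [ [] ] refl τ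
  where
  go : ∀ q → Nonempty q → ∀ τ → Nonempty (foldl step q τ)
  go q h []      = h
  go q h (d ∷ τ) = go (step q d) (step-nonempty q d) τ

queue≡nodes : ∀ x n → queue x n ≡ nodes (x ↾ n)
queue≡nodes x zero    = refl
queue≡nodes x (suc n) = trans (cong (λ q → step q (x n)) (queue≡nodes x n))
  (sym (trans (cong nodes (↾-suc x n)) (nodes-∷ʳ (x ↾ n) (x n))))

-- The survival probability of a node whose children, present as prescribed by a random
-- digit, survive independently with probabilities u and v.
offspring : ℚ → ℚ → ℚ → ℚ
offspring c u v = c ℚ.* u ℚ.+ c ℚ.* v ℚ.+ (1ℚ ℚ.- (1ℚ ℚ.+ 1ℚ) ℚ.* c) ℚ.* (u ℚ.+ v ℚ.- u ℚ.* v)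

offspringᵖ : ∀ {n} → Polynomial n → Polynomial n → Polynomial n → Polynomial n
offspringᵖ c u v = c :* u :+ c :* v :+ (con 1ℚ :- (con 1ℚ :+ con 1ℚ) :* c) :* (u :+ v :- u :* v)

module _ (h : List (Fin 2) → ℚ) where

  allDie : List (List (Fin 2)) → ℚ
  allDie []      = 1ℚ
  allDie (σ ∷ q) = (1ℚ ℚ.- h σ) ℚ.* allDie q

  survive : List (List (Fin 2)) → ℚ
  survive q = 1ℚ ℚ.- allDie q

  allDie-++ : ∀ q r → allDie (q ++ r) ≡ allDie q ℚ.* allDie r
  allDie-++ []      r = sym (ℚ.*-identityˡ _)
  allDie-++ (σ ∷ q) r = trans (cong ((1ℚ ℚ.- h σ) ℚ.*_) (allDie-++ q r)) (sym (ℚ.*-assoc (1ℚ ℚ.- h σ) _ _))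

  allDie≡1 : ∀ q → (∀ τ → τ ∈ₗ q → h τ ≡ 0ℚ) → allDie q ≡ 1ℚ
  allDie≡1 []      _ = refl
  allDie≡1 (σ ∷ q) z =
    cong₂ (λ u p → (1ℚ ℚ.- u) ℚ.* p) (z σ (here refl)) (allDie≡1 q (λ τ m → z τ (there m)))

  module _ (0≤h : ∀ σ → 0ℚ ℚ.≤ h σ) (h≤1 : ∀ σ → h σ ℚ.≤ 1ℚ) where

    0≤allDie : ∀ q → 0ℚ ℚ.≤ allDie q
    0≤allDie []      = ℚ.<⇒≤ 0<1
    0≤allDie (σ ∷ q) = 0≤p*q (p≤q⇒0≤q-p (h≤1 σ)) (0≤allDie q)

    survive≤1 : ∀ q → survive q ℚ.≤ 1ℚ
    survive≤1 q = p+e≡q⇒p≤q (0≤allDie q) (solve 1 (λ p → (con 1ℚ :- p) :+ p := con 1ℚ) refl (allDie q))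

    0≤survive : ∀ q → 0ℚ ℚ.≤ survive q
    0≤survive []      = ℚ.≤-refl
    0≤survive (σ ∷ q) = ℚ.≤-trans (0≤survive q) (p+e≡q⇒p≤q (0≤p*q (0≤h σ) (0≤allDie q))
      (solve 2 (λ u p → (con 1ℚ :- p) :+ u :* p := con 1ℚ :- (con 1ℚ :- u) :* p) refl (h σ) (allDie q)))

    module _ {β : ℚ} (subharmonic : ∀ σ → h σ ℚ.≤ offspring β (h (σ ∷ʳ 0F)) (h (σ ∷ʳ 1F))) where

      -- `offspring c u v` is linear in `c` with slope `-(u (1 - v) + v (1 - u))`, which is
      -- nonpositive for `u`, `v` in [0,1]. So a single rational `β` serves every approximation to
      -- `b` that stays below it.
      offspring-anti : ∀ {c} → c ℚ.≤ β → ∀ σ → h σ ℚ.≤ offspring c (h (σ ∷ʳ 0F)) (h (σ ∷ʳ 1F))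
      offspring-anti {c} c≤β σ = ℚ.≤-trans (subharmonic σ) (p+e≡q⇒p≤q
        (0≤p*q (p≤q⇒0≤q-p c≤β) (0≤p+q (0≤p*q (0≤h (σ ∷ʳ 0F)) (p≤q⇒0≤q-p (h≤1 (σ ∷ʳ 1F))))
                                     (0≤p*q (0≤h (σ ∷ʳ 1F)) (p≤q⇒0≤q-p (h≤1 (σ ∷ʳ 0F))))))
        (identity c β (h (σ ∷ʳ 0F)) (h (σ ∷ʳ 1F))))
        where
        identity : ∀ c β u v →
          offspring β u v ℚ.+ (β ℚ.- c) ℚ.* (u ℚ.* (1ℚ ℚ.- v) ℚ.+ v ℚ.* (1ℚ ℚ.- u)) ≡ offspring c u v
        identity = solve 4 (λ c β u v →
          offspringᵖ β u v :+ (β :- c) :* (u :* (con 1ℚ :- v) :+ v :* (con 1ℚ :- u)) :=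
          offspringᵖ c u v) refl

      -- The digit acts only on the factor of the front node `σ`. Averaging over the digit replaces
      -- `1 - h σ` in the product by one minus the offspring value, so the right side exceeds the
      -- left by `allDie t` times the slack in the inequality for `σ`.
      survive-step : ∀ {c} → c ℚ.≤ β → ∀ {q} → Nonempty q →
        survive q ℚ.≤ c ℚ.* survive (step q 0F) ℚ.+ c ℚ.* survive (step q 1F)
                      ℚ.+ (1ℚ ℚ.- (1ℚ ℚ.+ 1ℚ) ℚ.* c) ℚ.* survive (step q 2F)
      survive-step {c} c≤β {σ ∷ t} _ = p+e≡q⇒p≤q
        (0≤p*q (0≤allDie t) (p≤q⇒0≤q-p (offspring-anti c≤β σ)))
        (trans (identity c (allDie t) (h σ) (h (σ ∷ʳ 0F)) (h (σ ∷ʳ 1F)))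
          (sym (cong₂ (λ a b → a ℚ.+ (1ℚ ℚ.- (1ℚ ℚ.+ 1ℚ) ℚ.* c) ℚ.* (1ℚ ℚ.- b))
            (cong₂ (λ a b → c ℚ.* (1ℚ ℚ.- a) ℚ.+ c ℚ.* (1ℚ ℚ.- b)) (allDie-++ t _) (allDie-++ t _))
            (allDie-++ t _))))
        where
        identity : ∀ c R s u v →
          (1ℚ ℚ.- (1ℚ ℚ.- s) ℚ.* R) ℚ.+ R ℚ.* (offspring c u v ℚ.- s) ≡
          c ℚ.* (1ℚ ℚ.- R ℚ.* ((1ℚ ℚ.- u) ℚ.* 1ℚ)) ℚ.+ c ℚ.* (1ℚ ℚ.- R ℚ.* ((1ℚ ℚ.- v) ℚ.* 1ℚ))
            ℚ.+ (1ℚ ℚ.- (1ℚ ℚ.+ 1ℚ) ℚ.* c) ℚ.* (1ℚ ℚ.- R ℚ.* ((1ℚ ℚ.- u) ℚ.* ((1ℚ ℚ.- v) ℚ.* 1ℚ)))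
        identity = solve 5 (λ c R s u v →
          (con 1ℚ :- (con 1ℚ :- s) :* R) :+ R :* (offspringᵖ c u v :- s) :=
          c :* (con 1ℚ :- R :* ((con 1ℚ :- u) :* con 1ℚ)) :+ c :* (con 1ℚ :- R :* ((con 1ℚ :- v) :* con 1ℚ))
            :+ (con 1ℚ :- (con 1ℚ :+ con 1ℚ) :* c)
              :* (con 1ℚ :- R :* ((con 1ℚ :- u) :* ((con 1ℚ :- v) :* con 1ℚ)))) refl

module _ (em : ExcludedMiddle (lsuc 0ℓ)) {b : ℝ} {d : List (Fin 3) → ℝ}
  (0≤d : ∀ σ → 0ℝ ≤ d σ) (d[]≈1 : d [] ≈ 1ℝ)
  (d0 : ∀ σ → d (σ ∷ʳ 0F) ≈ b * d σ)
  (d1 : ∀ σ → d (σ ∷ʳ 1F) ≈ b * d σ)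
  (d2 : ∀ σ → d (σ ∷ʳ 2F) ≈ (1ℝ - 2ℝ * b) * d σ)
  (m : BorelProbability (lsuc 0ℓ) (Fin 3)) (cyl : HasCylinderValues m d)
  {β : ℚ} (b≤β : Eventually (λ n → seq b n ℚ.≤ β))
  {T : Pred (List (Fin 2)) 0ℓ} (pc : ParentClosed T)
  (h : List (Fin 2) → ℚ) (0≤h : ∀ σ → 0ℚ ℚ.≤ h σ) (h≤1 : ∀ σ → h σ ℚ.≤ 1ℚ)
  (h∉T : ∀ σ → σ ∉ T → h σ ≡ 0ℚ)
  (subharmonic : ∀ σ → h σ ℚ.≤ offspring β (h (σ ∷ʳ 0F)) (h (σ ∷ʳ 1F)))
  where

  W : List (Fin 3) → ℚ
  W τ = survive h (nodes τ)

  0≲W : ∀ τ → 0ℝ ≲ fromℚ (W τ)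
  0≲W τ = fromℚ-mono (0≤survive h 0≤h h≤1 (nodes τ))

  W-step : ∀ τ → fromℚ (W τ) * d τ ≲
    fromℚ (W (τ ∷ʳ 0F)) * d (τ ∷ʳ 0F) + fromℚ (W (τ ∷ʳ 1F)) * d (τ ∷ʳ 1F) + fromℚ (W (τ ∷ʳ 2F)) * d (τ ∷ʳ 2F)
  W-step τ = begin
    fromℚ (W τ) * d τ
      -- The rational inequality holds at every approximation to `b` below `β`, hence eventually,
      -- hence for the real `b`.
      ≤⟨ *-monoʳ (d τ) ⟨ 0≤d τ ⟩ (eventually⇒≲ {y = average} (ev-map pointwise b≤β)) ⟩
    average * d τ
      ≈⟨ pointwise⇒≅ {average * d τ} (λ n → solve 5 (λ c e w₀ w₁ w₂ →
           (c :* w₀ :+ c :* w₁ :+ (con 1ℚ :- (con 1ℚ :+ con 1ℚ) :* c) :* w₂) :* e :=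
           w₀ :* (c :* e) :+ w₁ :* (c :* e) :+ w₂ :* ((con 1ℚ :- (con 1ℚ :+ con 1ℚ) :* c) :* e)) refl
           (seq b n) (seq (d τ) n) (W (τ ∷ʳ 0F)) (W (τ ∷ʳ 1F)) (W (τ ∷ʳ 2F))) ⟩
    fromℚ (W (τ ∷ʳ 0F)) * (b * d τ) + fromℚ (W (τ ∷ʳ 1F)) * (b * d τ)
      + fromℚ (W (τ ∷ʳ 2F)) * ((1ℝ - 2ℝ * b) * d τ)
      ≤⟨ +-mono (+-mono (W-mono 0F (d0 τ)) (W-mono 1F (d1 τ))) (W-mono 2F (d2 τ)) ⟩
    fromℚ (W (τ ∷ʳ 0F)) * d (τ ∷ʳ 0F) + fromℚ (W (τ ∷ʳ 1F)) * d (τ ∷ʳ 1F) + fromℚ (W (τ ∷ʳ 2F)) * d (τ ∷ʳ 2F) ∎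
    where
    open ≲-Reasoning
    W-mono : ∀ i {x y} → x ≈ y → fromℚ (W (τ ∷ʳ i)) * y ≲ fromℚ (W (τ ∷ʳ i)) * x
    W-mono i x≈y = *-monoˡ (fromℚ (W (τ ∷ʳ i))) (0≲W (τ ∷ʳ i)) (≅⇒≳ (≈⇒≅ x≈y))
    average : ℝ
    average = b * fromℚ (W (τ ∷ʳ 0F)) + b * fromℚ (W (τ ∷ʳ 1F)) + (1ℝ - 2ℝ * b) * fromℚ (W (τ ∷ʳ 2F))
    s : List (List (Fin 2)) → ℚ
    s = survive h
    pointwise : ∀ n → seq b n ℚ.≤ β → W τ ℚ.≤ seq average n
    pointwise n bₙ≤β = subst (W τ ℚ.≤_)
      (cong₂ ℚ._+_
        (cong₂ (λ p q → seq b n ℚ.* s p ℚ.+ seq b n ℚ.* s q) (sym (nodes-∷ʳ τ 0F)) (sym (nodes-∷ʳ τ 1F)))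
        (cong (λ p → (1ℚ ℚ.- (1ℚ ℚ.+ 1ℚ) ℚ.* seq b n) ℚ.* s p) (sym (nodes-∷ʳ τ 2F))))
      (survive-step h 0≤h h≤1 subharmonic bₙ≤β (nodes-nonempty τ))

  meets : ℕ → Pred (Seq (Fin 3)) (lsuc 0ℓ)
  meets L x = Lift (lsuc 0ℓ) (Meets T L x)

  queue-cong : ∀ {x y} n → x ↾ n ≡ y ↾ n → queue x n ≡ queue y n
  queue-cong {x} {y} n eq = trans (queue≡nodes x n) (trans (cong nodes eq) (sym (queue≡nodes y n)))

  meets-Borel : ∀ L → Borel (meets L)
  meets-Borel L = open-set (depends-on-prefix⇒Open L λ { x y eq (lift (τ , τ∈q , τ∈T)) →
    lift (τ , subst (τ ∈ₗ_) (sym (queue-cong {y} {x} L eq)) τ∈q , τ∈T) })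

  meets-decreasing : ∀ L → meets (suc L) ⊆ meets L
  meets-decreasing L {x} (lift (τ , τ∈q , τ∈T)) with ∈-++⁻ (drop 1 (queue x L)) τ∈q
  ... | inj₁ τ∈r = lift (τ , subst (τ ∈ₗ_) (sym (queue≡ x L)) (there τ∈r) , τ∈T)
  ... | inj₂ τ∈c with ∈-children⁻ (x L) τ∈c
  ...   | i , _ , refl = lift (visited x L , visited∈queue x L , pc _ i τ∈T)

  -- Backward induction from the horizon `L`, with `k` digits still to be read. When none is left,
  -- either the cylinder lies inside `meets L`, where `W τ ≤ 1` suffices, or every node of the queue
  -- is off `T` and `W τ` is 0. Before that, `W-step` distributes the weight over the three digits.
  meets-in-cylinder : ∀ k τ {L} → length τ ℕ.+ k ≡ L → fromℚ (W τ) * d τ ≲ μ m (meets L ∩ I τ)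
  meets-in-cylinder zero τ {L} eq with em {Lift _ (∃[ σ ] (σ ∈ₗ nodes τ × σ ∈ T))}
  ... | yes (lift (σ , σ∈q , σ∈T)) = begin
      fromℚ (W τ) * d τ       ≤⟨ *-monoʳ (d τ) ⟨ 0≤d τ ⟩ (fromℚ-mono (survive≤1 h 0≤h h≤1 (nodes τ))) ⟩
      1ℝ * d τ                ≈⟨ pointwise⇒≅ {1ℝ * d τ} (λ n → ℚ.*-identityˡ (seq (d τ) n)) ⟩
      d τ                     ≈⟨ ≈⇒≅ (cyl τ) ⟨
      μ m (I τ)               ≈⟨ μ-≅ em m (Borel-I τ) (Borel-∩ em (meets-Borel L) (Borel-I τ)) (into , proj₂) ⟩
      μ m (meets L ∩ I τ)     ∎
    where
    open ≲-Reasoning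
    into : I τ ⊆ meets L ∩ I τ
    into {x} (lift τ⊏x) = lift (σ , subst (σ ∈ₗ_) (sym queue≡τ) σ∈q , σ∈T) , lift τ⊏x
      where
      queue≡τ : queue x L ≡ nodes τ
      queue≡τ = trans (cong (queue x) (trans (sym eq) (ℕ.+-identityʳ _)))
                      (trans (queue≡nodes x (length τ)) (cong nodes τ⊏x))
  ... | no none = begin
      fromℚ (W τ) * d τ       ≡⟨ cong (λ w → fromℚ (1ℚ ℚ.- w) * d τ) (allDie≡1 h (nodes τ) λ σ σ∈q →
                                   h∉T σ (λ σ∈T → none (lift (σ , σ∈q , σ∈T)))) ⟩
      0ℝ * d τ                ≈⟨ pointwise⇒≅ {0ℝ * d τ} (λ n → ℚ.*-zeroˡ (seq (d τ) n)) ⟩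
      0ℝ                      ≤⟨ ⟨ μ-nonneg m (Borel-∩ em (meets-Borel L) (Borel-I τ)) ⟩ ⟩
      μ m (meets L ∩ I τ)     ∎
    where open ≲-Reasoning
  meets-in-cylinder (suc k) τ {L} eq = begin
      fromℚ (W τ) * d τ
        ≤⟨ W-step τ ⟩
      fromℚ (W (τ ∷ʳ 0F)) * d (τ ∷ʳ 0F) + fromℚ (W (τ ∷ʳ 1F)) * d (τ ∷ʳ 1F) + fromℚ (W (τ ∷ʳ 2F)) * d (τ ∷ʳ 2F)
        ≤⟨ +-mono (+-mono (≲-trans (part 0F) (≅⇒≳ (+-identityˡ _))) (part 1F)) (part 2F) ⟩
      partialSum (λ i → μ m (child em m (meets-Borel L) τ i)) 3
        ≈⟨ μ-children em m (meets-Borel L) τ ⟨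
      μ m (meets L ∩ I τ) ∎
    where
    open ≲-Reasoning
    part : ∀ i → fromℚ (W (τ ∷ʳ i)) * d (τ ∷ʳ i) ≲ μ m (child em m (meets-Borel L) τ (toℕ i))
    part i = ≲-trans (meets-in-cylinder k (τ ∷ʳ i)
        (trans (cong (ℕ._+ k) (length-∷ʳ τ i)) (trans (sym (ℕ.+-suc (length τ) k)) eq)))
      (≅⇒≳ (μ-child em m (meets-Borel L) τ i))

  h[]≲meets : ∀ L → fromℚ (h []) ≲ μ m (meets L)
  h[]≲meets L = begin
    fromℚ (h [])             ≈⟨ pointwise⇒≅ (λ _ → solve 1 (λ u →
                                  u := (con 1ℚ :- (con 1ℚ :- u) :* con 1ℚ) :* con 1ℚ) refl (h [])) ⟩
    fromℚ (W []) * 1ℝ        ≤⟨ *-monoˡ (fromℚ (W [])) (0≲W []) (≅⇒≳ (≈⇒≅ d[]≈1)) ⟩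
    fromℚ (W []) * d []      ≤⟨ meets-in-cylinder L [] refl ⟩
    μ m (meets L ∩ I [])     ≤⟨ μ-mono em m (meets-Borel L) (Borel-∩ em (meets-Borel L) (Borel-I [])) proj₁ ⟩
    μ m (meets L)            ∎
    where open ≲-Reasoning

  -- `μ m` is constrained only on Borel sets, and `Codes` is defined by quantifying over closed
  -- sets. Its equality with the intersection of the open sets `meets L` shows that it is Borel and
  -- lets continuity from above apply.
  h[]≲capacity : fromℚ (h []) ≲ capacity m (Paths T)
  h[]≲capacity = ≲-trans (μ-⋂-≥ em m meets-Borel meets-decreasing h[]≲meets)
    (≅⇒≲ (μ-≅ em m ⋂-Borel (resp-≐ meets≐codes ⋂-Borel) meets≐codes))
    where
    ⋂-Borel : Borel (⋂ ℕ meets)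
    ⋂-Borel = Borel-⋂ em meets-Borel
    meets≐codes : ⋂ ℕ meets ≐ Codes (_≬ Paths T)
    meets≐codes = (λ {x} ms → Meets⇒Codes (em-lower em) x pc (λ L → lower (ms L)))
                , (λ {x} c L → lift (Codes⇒Meets (em-lower em) x pc c L))

-- The tree

-- The phase j is the number of free positions left before the next forced 1.

countdown : ℕ → ℕ → ℕ
countdown p zero    = p
countdown p (suc j) = j

Permits : ℕ → Fin 2 → Set
Permits zero    i = i ≡ 1F
Permits (suc _) i = ⊤

OkFrom : ℕ → ℕ → Pred (List (Fin 2)) 0ℓ
OkFrom p j []      = ⊤
OkFrom p j (i ∷ σ) = Permits j i × OkFrom p (countdown p j) σ

T : ℕ → Pred (List (Fin 2)) 0ℓ
T p = OkFrom p 0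

phaseFrom : ℕ → ℕ → List (Fin 2) → ℕ
phaseFrom p j []      = j
phaseFrom p j (_ ∷ σ) = phaseFrom p (countdown p j) σ

phase : ℕ → List (Fin 2) → ℕ
phase p = phaseFrom p 0

phase-∷ʳ : ∀ p j σ i → phaseFrom p j (σ ∷ʳ i) ≡ countdown p (phaseFrom p j σ)
phase-∷ʳ p j []      i = refl
phase-∷ʳ p j (_ ∷ σ) i = phase-∷ʳ p (countdown p j) σ i

OkFrom-∷ʳ⁺ : ∀ p j σ i → OkFrom p j σ → Permits (phaseFrom p j σ) i → OkFrom p j (σ ∷ʳ i)
OkFrom-∷ʳ⁺ p j []      i _        q = q , tt
OkFrom-∷ʳ⁺ p j (_ ∷ σ) i (o , os) q = o , OkFrom-∷ʳ⁺ p (countdown p j) σ i os q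

OkFrom-∷ʳ⁻ : ∀ p j σ i → OkFrom p j (σ ∷ʳ i) → OkFrom p j σ × Permits (phaseFrom p j σ) i
OkFrom-∷ʳ⁻ p j []      i (o , _)  = tt , o
OkFrom-∷ʳ⁻ p j (_ ∷ σ) i (o , os) = let os′ , q = OkFrom-∷ʳ⁻ p (countdown p j) σ i os in (o , os′) , q

T-parent : ∀ p → ParentClosed (T p)
T-parent p σ i h = proj₁ (OkFrom-∷ʳ⁻ p 0 σ i h)

permits? : ∀ j i → Dec (Permits j i)
permits? zero    i = i Fin.≟ 1F
permits? (suc _) i = yes tt

okFrom? : ∀ p j σ → Dec (OkFrom p j σ)
okFrom? p j []      = yes tt
okFrom? p j (i ∷ σ) = permits? j i ×-dec okFrom? p (countdown p j) σ

-- Computability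

predecessor : Rec 1
predecessor = prec zer (proj 0F)

predecessor↓ : ∀ n → predecessor [ n ∷ [] ]↓ ℕ.pred n
predecessor↓ zero    = prec↓-zero zer↓
predecessor↓ (suc n) = prec↓-suc (predecessor↓ n) proj↓

-- Arguments in reverse order, as the recursion is on the subtrahend.
monus : Rec 2
monus = prec (proj 0F) (comp predecessor (proj 1F ∷ []))

monus↓ : ∀ n m → monus [ n ∷ m ∷ [] ]↓ m ℕ.∸ n
monus↓ zero    m = prec↓-zero proj↓
monus↓ (suc n) m = subst (monus [ suc n ∷ m ∷ [] ]↓_) (ℕ.pred[m∸n]≡m∸[1+n] m n)
  (prec↓-suc (monus↓ n m) (comp↓ {ys = m ℕ.∸ n ∷ []} (λ { 0F → proj↓ }) (predecessor↓ (m ℕ.∸ n))))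

one : ∀ {n} → Rec n
one = comp succ (zer ∷ [])

one↓ : ∀ {n} {xs : Vec ℕ n} → one [ xs ]↓ 1
one↓ = comp↓ {ys = 0 ∷ []} (λ { 0F → zer↓ }) succ↓

parity : ℕ → ℕ
parity zero    = 0
parity (suc n) = 1 ℕ.∸ parity n

parityRec : Rec 1
parityRec = prec zer (comp monus (proj 1F ∷ one ∷ []))

parityRec↓ : ∀ n → parityRec [ n ∷ [] ]↓ parity n
parityRec↓ zero    = prec↓-zero zer↓
parityRec↓ (suc n) = prec↓-suc (parityRec↓ n)
  (comp↓ {ys = parity n ∷ 1 ∷ []} (λ { 0F → proj↓ ; 1F → one↓ }) (monus↓ (parity n) 1))

-- On codes this deletes the first entry: n ↦ ⌊(n ∸ 1) / 2⌋, and consecutive values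
-- add up to n ∸ 1.
shift : ℕ → ℕ
shift zero    = 0
shift (suc n) = ℕ.pred n ℕ.∸ shift n

shiftRec : Rec 1
shiftRec = prec zer (comp monus (proj 1F ∷ comp predecessor (proj 0F ∷ []) ∷ []))

shiftRec↓ : ∀ n → shiftRec [ n ∷ [] ]↓ shift n
shiftRec↓ zero    = prec↓-zero zer↓
shiftRec↓ (suc n) = prec↓-suc (shiftRec↓ n)
  (comp↓ {ys = shift n ∷ ℕ.pred n ∷ []}
    (λ { 0F → proj↓ ; 1F → comp↓ {ys = n ∷ []} (λ { 0F → proj↓ }) (predecessor↓ n) })
    (monus↓ (shift n) (ℕ.pred n)))

shifts : ℕ → ℕ → ℕ
shifts zero    n = n
shifts (suc k) n = shift (shifts k n)

shiftsRec : ℕ → Rec 1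
shiftsRec zero    = proj 0F
shiftsRec (suc k) = comp shiftRec (shiftsRec k ∷ [])

shiftsRec↓ : ∀ k n → shiftsRec k [ n ∷ [] ]↓ shifts k n
shiftsRec↓ zero    n = proj↓
shiftsRec↓ (suc k) n = comp↓ {ys = shifts k n ∷ []} (λ { 0F → shiftsRec↓ k n }) (shiftRec↓ (shifts k n))

-- On codes this deletes the first `k * suc p` entries, so that the remaining string starts at a
-- forced position.
blocks : ℕ → ℕ → ℕ → ℕ
blocks p zero    n = n
blocks p (suc k) n = shifts (suc p) (blocks p k n)

blocksRec : ℕ → Rec 2
blocksRec p = prec (proj 0F) (comp (shiftsRec (suc p)) (proj 1F ∷ []))

blocksRec↓ : ∀ p k n → blocksRec p [ k ∷ n ∷ [] ]↓ blocks p k n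
blocksRec↓ p zero    n = prec↓-zero proj↓
blocksRec↓ p (suc k) n = prec↓-suc (blocksRec↓ p k n)
  (comp↓ {ys = blocks p k n ∷ []} (λ { 0F → proj↓ }) (shiftsRec↓ (suc p) (blocks p k n)))

-- In bijective base 2 a code is even exactly when the string is empty or starts with 1. So a 0 at
-- one of the first `k` forced positions subtracts 1, and truncated subtraction keeps the value at 0
-- from then on.
good : ℕ → ℕ → ℕ → ℕ
good p zero    n = 1
good p (suc k) n = good p k n ℕ.∸ parity (blocks p k n)

goodRec : ℕ → Rec 2
goodRec p = prec one
  (comp monus (comp parityRec (comp (blocksRec p) (proj 0F ∷ proj 2F ∷ []) ∷ []) ∷ proj 1F ∷ []))

goodRec↓ : ∀ p k n → goodRec p [ k ∷ n ∷ [] ]↓ good p k n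
goodRec↓ p zero    n = prec↓-zero one↓
goodRec↓ p (suc k) n = prec↓-suc (goodRec↓ p k n)
  (comp↓ {ys = parity (blocks p k n) ∷ good p k n ∷ []}
    (λ { 0F → comp↓ {ys = blocks p k n ∷ []}
                (λ { 0F → comp↓ {ys = k ∷ n ∷ []} (λ { 0F → proj↓ ; 1F → proj↓ }) (blocksRec↓ p k n) })
                (parityRec↓ (blocks p k n))
       ; 1F → proj↓ })
    (monus↓ (parity (blocks p k n)) (good p k n)))

-- The code itself serves as the number of forced positions to test: it is at least the length of
-- the string (`length≤code`), and tests past the end succeed because the empty string has code 0.
T-program : ℕ → Rec 1
T-program p = comp (goodRec p) (proj 0F ∷ proj 0F ∷ [])

T-program↓ : ∀ p n → T-program p [ n ∷ [] ]↓ good p n n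
T-program↓ p n = comp↓ {ys = n ∷ n ∷ []} (λ { 0F → proj↓ ; 1F → proj↓ }) (goodRec↓ p n n)

n+n≡2*n : ∀ n → n ℕ.+ n ≡ 2 ℕ.* n
n+n≡2*n n = cong (n ℕ.+_) (sym (ℕ.+-identityʳ n))

parity-even : ∀ n → parity (n ℕ.+ n) ≡ 0
parity-even zero    = refl
parity-even (suc n) rewrite ℕ.+-suc n n | parity-even n = refl

shift-odd  : ∀ n → shift (suc (n ℕ.+ n)) ≡ n
shift-even : ∀ n → shift (suc (suc (n ℕ.+ n))) ≡ n
shift-odd zero    = refl
shift-odd (suc n) rewrite ℕ.+-suc n n | shift-even n = ℕ.m+n∸n≡m (suc n) n
shift-even zero    = refl
shift-even (suc n) =
  trans (cong (ℕ.pred (suc (suc n ℕ.+ suc n)) ℕ.∸_) (shift-odd (suc n))) (ℕ.m+n∸n≡m (suc n) (suc n))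

shift-code : ∀ σ → shift (code σ) ≡ code (drop 1 σ)
shift-code []       = refl
shift-code (0F ∷ σ) = trans (cong (λ n → shift (suc n)) (sym (n+n≡2*n (code σ)))) (shift-odd (code σ))
shift-code (1F ∷ σ) = trans (cong (λ n → shift (suc (suc n))) (sym (n+n≡2*n (code σ)))) (shift-even (code σ))

shifts-code : ∀ k σ → shifts k (code σ) ≡ code (drop k σ)
shifts-code zero    σ = refl
shifts-code (suc k) σ = trans (cong shift (shifts-code k σ)) (trans (shift-code (drop k σ))
  (cong code (trans (List.drop-drop k 1 σ) (cong (λ n → drop n σ) (ℕ.+-comm k 1)))))

blocks-code : ∀ p k σ → blocks p k (code σ) ≡ code (drop (k ℕ.* suc p) σ)
blocks-code p zero    σ = refl
blocks-code p (suc k) σ = trans (cong (shifts (suc p)) (blocks-code p k σ))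
  (trans (shifts-code (suc p) (drop (k ℕ.* suc p) σ))
    (cong code (trans (List.drop-drop (k ℕ.* suc p) (suc p) σ)
                      (cong (λ n → drop n σ) (ℕ.+-comm (k ℕ.* suc p) (suc p))))))

parity-permits : ∀ i σ → parity (code (i ∷ σ)) ≡ 0 → i ≡ 1F
parity-permits 1F σ _ = refl
parity-permits 0F σ h rewrite sym (n+n≡2*n (code σ)) | parity-even (code σ) with () ← h

parity-1∷ : ∀ σ → parity (code (1F ∷ σ)) ≡ 0
parity-1∷ σ rewrite sym (n+n≡2*n (code σ)) | parity-even (code σ) = refl

OkFrom-drop⁺ : ∀ p j σ → OkFrom p j σ → T p (drop j σ)
OkFrom-drop⁺ p zero    σ       h       = h
OkFrom-drop⁺ p (suc j) []      h       = tt
OkFrom-drop⁺ p (suc j) (_ ∷ σ) (_ , h) = OkFrom-drop⁺ p j σ h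

OkFrom-drop⁻ : ∀ p j σ → T p (drop j σ) → OkFrom p j σ
OkFrom-drop⁻ p zero    σ       h = h
OkFrom-drop⁻ p (suc j) []      h = tt
OkFrom-drop⁻ p (suc j) (_ ∷ σ) h = tt , OkFrom-drop⁻ p j σ h

T⇒parity : ∀ p k σ → T p σ → parity (code (drop (k ℕ.* suc p) σ)) ≡ 0
T⇒parity p zero    []       _          = refl
T⇒parity p zero    (1F ∷ σ) _          = parity-1∷ σ
T⇒parity p (suc k) []       _          = refl
T⇒parity p (suc k) (_ ∷ σ)  (_ , h)    =
  trans (cong (λ τ → parity (code τ)) (sym (List.drop-drop p (k ℕ.* suc p) σ)))
        (T⇒parity p k (drop p σ) (OkFrom-drop⁺ p p σ h))

parity⇒T : ∀ p n σ → length σ ℕ.≤ n → (∀ k → k ℕ.< n → parity (code (drop (k ℕ.* suc p) σ)) ≡ 0) → T p σ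
parity⇒T p n       []      _          _ = tt
parity⇒T p (suc n) (i ∷ σ) (ℕ.s≤s le) h = parity-permits i σ (h 0 (ℕ.s≤s ℕ.z≤n)) ,
  OkFrom-drop⁻ p p σ (parity⇒T p n (drop p σ)
    (ℕ.≤-trans (ℕ.≤-trans (ℕ.≤-reflexive (List.length-drop p σ)) (ℕ.m∸n≤m (length σ) p)) le)
    (λ k k<n → trans (cong (λ τ → parity (code τ)) (List.drop-drop p (k ℕ.* suc p) σ))
                     (h (suc k) (ℕ.s≤s k<n))))

good-1 : ∀ p k n → (∀ j → parity (blocks p j n) ≡ 0) → good p k n ≡ 1
good-1 p zero    n h = refl
good-1 p (suc k) n h = trans (cong (good p k n ℕ.∸_) (h k)) (good-1 p k n h)

good≤1 : ∀ p k n → good p k n ℕ.≤ 1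
good≤1 p zero    n = ℕ.≤-refl
good≤1 p (suc k) n = ℕ.≤-trans (ℕ.m∸n≤m (good p k n) (parity (blocks p k n))) (good≤1 p k n)

1≤m∸n⇒n≡0 : ∀ {m n} → m ℕ.≤ 1 → 1 ℕ.≤ m ℕ.∸ n → n ≡ 0
1≤m∸n⇒n≡0 {n = zero}                 _          _  = refl
1≤m∸n⇒n≡0 {suc zero} {suc zero}      _          ()
1≤m∸n⇒n≡0 {suc zero} {suc (suc n)}   _          ()
1≤m∸n⇒n≡0 {suc (suc m)} {suc n}      (ℕ.s≤s ()) _

1≤good⇒parity : ∀ p k n → 1 ℕ.≤ good p k n → ∀ j → j ℕ.< k → parity (blocks p j n) ≡ 0
1≤good⇒parity p (suc k) n h j (ℕ.s≤s j≤k) with ℕ.m≤n⇒m<n∨m≡n j≤k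
... | inj₂ refl = 1≤m∸n⇒n≡0 (good≤1 p k n) h
... | inj₁ j<k  = 1≤good⇒parity p k n (ℕ.≤-trans h (ℕ.m∸n≤m (good p k n) (parity (blocks p k n)))) j j<k

length≤code : ∀ σ → length σ ℕ.≤ code σ
length≤code []      = ℕ.z≤n
length≤code (i ∷ σ) = ℕ.s≤s (ℕ.≤-trans (length≤code σ)
  (ℕ.≤-trans (ℕ.m≤m+n (code σ) _) (ℕ.m≤n+m (2 ℕ.* code σ) (toℕ i))))

good⇒T : ∀ p σ → 1 ℕ.≤ good p (code σ) (code σ) → T p σ
good⇒T p σ h = parity⇒T p (code σ) σ (length≤code σ)
  (λ k k< → trans (cong parity (sym (blocks-code p k σ))) (1≤good⇒parity p (code σ) (code σ) h k k<))

T-computable : ∀ p → ComputableSet (T p)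
T-computable p = T-program p , λ σ →
  (λ h → subst (T-program p [ code σ ∷ [] ]↓_)
    (good-1 p (code σ) (code σ) (λ k → trans (cong parity (blocks-code p k σ)) (T⇒parity p k σ h)))
    (T-program↓ p (code σ))) ,
  (λ ¬h → subst (T-program p [ code σ ∷ [] ]↓_) (ℕ.n<1⇒n≡0 (ℕ.≰⇒> (λ le → ¬h (good⇒T p σ le))))
    (T-program↓ p (code σ)))

-- Archimedean property

fromℕ : ℕ → ℚ
fromℕ n = mkℚ (ℤ.+ n) 0 (Coprime.sym (1-coprimeTo n))

fromℕ-suc : ∀ n → fromℕ (suc n) ≡ fromℕ n ℚ.+ 1ℚ
fromℕ-suc n = ℚ.toℚᵘ-injective (ℚᵘ.≃-trans (*≡* (lemma (ℤ.+ n))) (ℚᵘ.≃-sym (ℚ.toℚᵘ-homo-+ (fromℕ n) 1ℚ)))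
  where
  lemma : ∀ z → (ℤ.+ 1 ℤ.+ z) ℤ.* ℤ.+ 1 ≡ (z ℤ.* ℤ.+ 1 ℤ.+ ℤ.+ 1 ℤ.* ℤ.+ 1) ℤ.* ℤ.+ 1
  lemma z = cong (ℤ._* ℤ.+ 1) (trans (ℤ.+-comm (ℤ.+ 1) z) (cong (ℤ._+ ℤ.+ 1) (sym (ℤ.*-identityʳ z))))

≤-fromℕ : ∀ q → ∃[ n ] q ℚ.≤ fromℕ n
≤-fromℕ (mkℚ (ℤ.+ n) d _)    = n , *≤* (subst₂ ℤ._≤_ (ℤ.pos-* n 1) (ℤ.pos-* n (suc d))
                                         (ℤ.+≤+ (ℕ.*-monoʳ-≤ n (ℕ.s≤s ℕ.z≤n))))
≤-fromℕ (mkℚ ℤ.-[1+ n ] d _) = 0 , *≤* ℤ.-≤+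

archimedean : ∀ {δ} → 0ℚ ℚ.< δ → ∃[ n ] 1ℚ ℚ.≤ fromℕ n ℚ.* δ
archimedean {δ} 0<δ = let e , _ , δe≡1 = divide δ 1ℚ 0<δ 0<1 ; n , e≤n = ≤-fromℕ e in
  n , subst (ℚ._≤ fromℕ n ℚ.* δ) (trans (ℚ.*-comm e δ) δe≡1)
        (ℚ.*-monoʳ-≤-nonNeg δ {{ℚ.nonNegative (ℚ.<⇒≤ 0<δ)}} e≤n)

½≤1 : ½ ℚ.≤ 1ℚ
½≤1 = p+e≡q⇒p≤q (ℚ.<⇒≤ 0<½) refl

0≤½^ : ∀ n → 0ℚ ℚ.≤ ½^ n
0≤½^ zero    = ℚ.<⇒≤ 0<1
0≤½^ (suc n) = 0≤p*q (ℚ.<⇒≤ 0<½) (0≤½^ n)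

½^≤1 : ∀ n → ½^ n ℚ.≤ 1ℚ
½^≤1 zero    = ℚ.≤-refl
½^≤1 (suc n) = ℚ.≤-trans (ℚ.*-monoˡ-≤-nonNeg ½ (½^≤1 n)) ½≤1

n*½^n≤1 : ∀ n → fromℕ n ℚ.* ½^ n ℚ.≤ 1ℚ
n*½^n≤1 zero    = ℚ.≤-trans (ℚ.≤-reflexive (ℚ.*-zeroˡ 1ℚ)) (ℚ.<⇒≤ 0<1)
n*½^n≤1 (suc n) = begin
  fromℕ (suc n) ℚ.* (½ ℚ.* ½^ n)                   ≡⟨ cong (ℚ._* (½ ℚ.* ½^ n)) (fromℕ-suc n) ⟩
  (fromℕ n ℚ.+ 1ℚ) ℚ.* (½ ℚ.* ½^ n)                ≡⟨ solve 2 (λ x y → (x :+ con 1ℚ) :* (con ½ :* y) :=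
                                                       con ½ :* (x :* y) :+ con ½ :* y) refl (fromℕ n) (½^ n) ⟩
  ½ ℚ.* (fromℕ n ℚ.* ½^ n) ℚ.+ ½ ℚ.* ½^ n          ≤⟨ ℚ.+-mono-≤ (ℚ.*-monoˡ-≤-nonNeg ½ (n*½^n≤1 n))
                                                                    (ℚ.*-monoˡ-≤-nonNeg ½ (½^≤1 n)) ⟩
  ½ ℚ.* 1ℚ ℚ.+ ½ ℚ.* 1ℚ                            ≡⟨⟩
  1ℚ                                               ∎
  where
  open ℚ.≤-Reasoning

½^-→0 : ∀ ε → 0ℚ ℚ.< ε → ∃[ n ] ½^ n ℚ.≤ ε
½^-→0 ε 0<ε = let n , 1≤nε = archimedean 0<ε in n , (begin
  ½^ n                         ≡⟨ ℚ.*-identityʳ (½^ n) ⟨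
  ½^ n ℚ.* 1ℚ                  ≤⟨ ℚ.*-monoˡ-≤-nonNeg (½^ n) {{ℚ.nonNegative (0≤½^ n)}} 1≤nε ⟩
  ½^ n ℚ.* (fromℕ n ℚ.* ε)     ≡⟨ solve 3 (λ x y e → y :* (x :* e) := (x :* y) :* e) refl (fromℕ n) (½^ n) ε ⟩
  (fromℕ n ℚ.* ½^ n) ℚ.* ε     ≤⟨ ℚ.*-monoʳ-≤-nonNeg ε {{ℚ.nonNegative (ℚ.<⇒≤ 0<ε)}} (n*½^n≤1 n) ⟩
  1ℚ ℚ.* ε                     ≡⟨ ℚ.*-identityˡ ε ⟩
  ε                            ∎)
  where
  open ℚ.≤-Reasoning

-- Lebesgue measure

-- The number of forced positions among the next `k`, starting in phase `j`; it is the number of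
-- extra halvings in `Paths-in-cylinder`.
forced : ℕ → ℕ → ℕ → ℕ
forced p zero    j       = 0
forced p (suc k) zero    = suc (forced p k p)
forced p (suc k) (suc j) = forced p k j

forced-surjective : ∀ p n j → ∃[ k ] forced p k j ≡ n
forced-surjective p zero    j       = 0 , refl
forced-surjective p (suc n) zero    = let k , eq = forced-surjective p n p in suc k , cong suc eq
forced-surjective p (suc n) (suc j) = let k , eq = forced-surjective p (suc n) j in suc k , eq

module _ (em : ExcludedMiddle 0ℓ) (p : ℕ) (leb : BorelProbability 0ℓ (Fin 2)) (fair : IsFairCoin leb) where

  Paths-Borel : Borel (Paths (T p))
  Paths-Borel = Borel-⋂ em λ n → open-set (depends-on-prefix⇒Open n λ x y eq → subst (T p) (sym eq))

  Paths∩I-Borel : ∀ σ → Borel (Paths (T p) ∩ I σ)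
  Paths∩I-Borel σ = Borel-∩ em Paths-Borel (Borel-I σ)

  -- Each further position splits the bound into two halves. At a free position both children
  -- contribute and the bound is unchanged; at a forced one the child 0 contains no path of the
  -- tree, and one half is lost.
  Paths-in-cylinder : ∀ k j σ → phase p σ ≡ j →
    μ leb (Paths (T p) ∩ I σ) ≲ fromℚ (½^ (length σ ℕ.+ forced p k j))
  children-of-cylinder : ∀ k σ i → μ leb (child em leb Paths-Borel σ (toℕ i)) ≲
    fromℚ (½^ suc (length σ ℕ.+ forced p k (countdown p (phase p σ))))

  Paths-in-cylinder zero j σ eq = begin
    μ leb (Paths (T p) ∩ I σ)        ≤⟨ μ-mono em leb (Borel-I σ) (Paths∩I-Borel σ) proj₂ ⟩
    μ leb (I σ)                      ≈⟨ ≈⇒≅ (fair σ) ⟩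
    fromℚ (½^ length σ)              ≡⟨ cong (λ n → fromℚ (½^ n)) (ℕ.+-identityʳ (length σ)) ⟨
    fromℚ (½^ (length σ ℕ.+ 0))      ∎
    where open ≲-Reasoning
  Paths-in-cylinder (suc k) zero σ eq = begin
    μ leb (Paths (T p) ∩ I σ)        ≈⟨ μ-children em leb Paths-Borel σ ⟩
    (0ℝ + child₀) + child₁
      ≤⟨ +-mono (+-mono ≲-refl (≅⇒≲ (μ-empty em leb (child-Borel em leb Paths-Borel σ 0) dead)))
                (children-of-cylinder k σ 1F) ⟩
    (0ℝ + 0ℝ) + fromℚ (½^ suc (length σ ℕ.+ forced p k (countdown p (phase p σ))))
      ≈⟨ pointwise⇒≅ (λ _ → ℚ.+-identityˡ _) ⟩
    fromℚ (½^ suc (length σ ℕ.+ forced p k (countdown p (phase p σ))))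
      ≡⟨ cong (λ n → fromℚ (½^ n)) (trans (cong (λ j → suc (length σ ℕ.+ forced p k (countdown p j))) eq)
                                          (sym (ℕ.+-suc (length σ) (forced p k p)))) ⟩
    fromℚ (½^ (length σ ℕ.+ suc (forced p k p))) ∎
    where
    open ≲-Reasoning
    child₀ child₁ : ℝ
    child₀ = μ leb (child em leb Paths-Borel σ 0)
    child₁ = μ leb (child em leb Paths-Borel σ 1)
    dead : ∀ x → x ∉ child em leb Paths-Borel σ 0
    dead x (x∈Q , lift σ⊏x , lift x≡0)
      with trans (sym x≡0) (cong toℕ (subst (λ j → Permits j (x (length σ))) eq
             (proj₂ (OkFrom-∷ʳ⁻ p 0 σ _ (subst (T p) (trans (↾-suc x (length σ)) (cong (_∷ʳ x (length σ)) σ⊏x))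
               (x∈Q (suc (length σ))))))))
    ... | ()
  Paths-in-cylinder (suc k) (suc j) σ eq = begin
    μ leb (Paths (T p) ∩ I σ)        ≈⟨ μ-children em leb Paths-Borel σ ⟩
    (0ℝ + μ leb (child em leb Paths-Borel σ 0)) + μ leb (child em leb Paths-Borel σ 1)
      ≤⟨ +-mono (≲-trans (≅⇒≲ (+-identityˡ _)) (children-of-cylinder k σ 0F)) (children-of-cylinder k σ 1F) ⟩
    fromℚ (½ ℚ.* ½^ n) + fromℚ (½ ℚ.* ½^ n)
      ≈⟨ fromℚ-½+½ (½^ n) ⟩
    fromℚ (½^ n)
      ≡⟨ cong (λ j → fromℚ (½^ (length σ ℕ.+ forced p k (countdown p j)))) eq ⟩
    fromℚ (½^ (length σ ℕ.+ forced p k j)) ∎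
    where
    open ≲-Reasoning
    n : ℕ
    n = length σ ℕ.+ forced p k (countdown p (phase p σ))

  children-of-cylinder k σ i = begin
    μ leb (child em leb Paths-Borel σ (toℕ i))       ≈⟨ μ-child em leb Paths-Borel σ i ⟩
    μ leb (Paths (T p) ∩ I (σ ∷ʳ i))                 ≤⟨ Paths-in-cylinder k _ (σ ∷ʳ i) (phase-∷ʳ p 0 σ i) ⟩
    fromℚ (½^ (length (σ ∷ʳ i) ℕ.+ forced p k (countdown p (phase p σ))))
      ≡⟨ cong (λ l → fromℚ (½^ (l ℕ.+ forced p k (countdown p (phase p σ))))) (length-∷ʳ σ i) ⟩
    fromℚ (½^ suc (length σ ℕ.+ forced p k (countdown p (phase p σ)))) ∎
    where open ≲-Reasoning

  Paths-null : μ leb (Paths (T p)) ≅ 0ℝ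
  Paths-null = ≲-ε small & ⟨ μ-nonneg leb Paths-Borel ⟩
    where
    open ≲-Reasoning
    small : ∀ ε → 0ℚ ℚ.< ε → μ leb (Paths (T p)) ≲ 0ℝ + fromℚ ε
    small ε 0<ε = let n , ½^n≤ε = ½^-→0 ε 0<ε ; k , eq = forced-surjective p n 0 in begin
      μ leb (Paths (T p))                ≤⟨ μ-mono em leb (Paths∩I-Borel []) Paths-Borel (_, lift refl) ⟩
      μ leb (Paths (T p) ∩ I [])         ≤⟨ Paths-in-cylinder k 0 [] refl ⟩
      fromℚ (½^ forced p k 0)            ≡⟨ cong (λ n → fromℚ (½^ n)) eq ⟩
      fromℚ (½^ n)                       ≤⟨ fromℚ-mono ½^n≤ε ⟩
      fromℚ ε                            ≈⟨ +-identityˡ (fromℚ ε) ⟨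
      0ℝ + fromℚ ε                       ∎

-- A subharmonic function on T p

¼ : ℚ
¼ = ½ ℚ.* ½

0≤¼ : 0ℚ ℚ.≤ ¼
0≤¼ = ℚ.<⇒≤ (*-pos 0<½ 0<½)

¼≤½ : ¼ ℚ.≤ ½
¼≤½ = p+e≡q⇒p≤q 0≤¼ refl

module _ {ε : ℚ} (0<ε : 0ℚ ℚ.< ε) where

  δ : ℚ
  δ = ε ℚ.* ¼

  0<δ : 0ℚ ℚ.< δ
  0<δ = *-pos 0<ε (*-pos 0<½ 0<½)

  height : ℕ → ℚ
  height zero    = ¼
  height (suc j) = ½ ℚ.⊓ (height j ℚ.+ δ)

  height≤½ : ∀ j → height j ℚ.≤ ½
  height≤½ zero    = ¼≤½
  height≤½ (suc j) = ℚ.p⊓q≤p ½ (height j ℚ.+ δ)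

  ¼≤height : ∀ j → ¼ ℚ.≤ height j
  ¼≤height zero    = ℚ.≤-refl
  ¼≤height (suc j) = ℚ.⊓-glb ¼≤½ (ℚ.≤-trans (¼≤height j) (p+e≡q⇒p≤q (ℚ.<⇒≤ 0<δ) refl))

  -- Below the cap ½ the growth is linear with slope `δ`, so the archimedean property brings the
  -- height up to the cap; this determines the length `p` of the free stretches.
  height-grows : ∀ j → ½ ℚ.≤ height j ⊎ height j ≡ ¼ ℚ.+ fromℕ j ℚ.* δ
  height-grows zero = inj₂ (sym (trans (cong (¼ ℚ.+_) (ℚ.*-zeroˡ δ)) (ℚ.+-identityʳ ¼)))
  height-grows (suc j) with ℚ.⊓-sel ½ (height j ℚ.+ δ) | height-grows j
  ... | inj₁ eq | _         = inj₁ (ℚ.≤-reflexive (sym eq))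
  ... | inj₂ eq | inj₁ ½≤hⱼ = inj₁ (subst (½ ℚ.≤_) (sym eq) (ℚ.≤-trans ½≤hⱼ (p+e≡q⇒p≤q (ℚ.<⇒≤ 0<δ) refl)))
  ... | inj₂ eq | inj₂ hⱼ≡  = inj₂ (trans eq (trans (cong (ℚ._+ δ) hⱼ≡) (trans
    (solve 3 (λ q x d → (q :+ x :* d) :+ d := q :+ (x :+ con 1ℚ) :* d) refl ¼ (fromℕ j) δ)
    (cong (λ x → ¼ ℚ.+ x ℚ.* δ) (sym (fromℕ-suc j))))))

  height-reaches-½ : ∃[ p ] ½ ℚ.≤ height p
  height-reaches-½ with archimedean 0<δ
  ... | p , 1≤pδ with height-grows p
  ...   | inj₁ ½≤hₚ = p , ½≤hₚ
  ...   | inj₂ hₚ≡  = p , subst (½ ℚ.≤_) (sym hₚ≡)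
            (ℚ.≤-trans ½≤1 (ℚ.≤-trans 1≤pδ (p+e≡q⇒p≤q 0≤¼ (ℚ.+-comm (fromℕ p ℚ.* δ) ¼))))

  -- For `c = ½ - ε`, two children of weight `a` give `a + 2ε a (1 - a)`. On [¼, ½] the gain is at
  -- least `δ = ε/4`: the excess is `2ε ((a - ¼)(½ - a) + ¼ a)`.
  height-free : ∀ j → height (suc j) ℚ.≤ offspring (½ ℚ.- ε) (height j) (height j)
  height-free j = ℚ.≤-trans (ℚ.p⊓q≤q ½ (height j ℚ.+ δ)) (p+e≡q⇒p≤q
    (0≤p*q (0≤p+q (ℚ.<⇒≤ 0<ε) (ℚ.<⇒≤ 0<ε))
      (0≤p+q (0≤p*q (p≤q⇒0≤q-p (¼≤height j)) (p≤q⇒0≤q-p (height≤½ j)))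
             (0≤p*q 0≤¼ (ℚ.≤-trans 0≤¼ (¼≤height j)))))
    (solve 2 (λ e a →
      a :+ e :* con ¼ :+ (e :+ e) :* ((a :- con ¼) :* (con ½ :- a) :+ con ¼ :* a) :=
      offspringᵖ (con ½ :- e) a a) refl ε (height j)))

  -- With one child gone the value is `(½ + ε) v`, so a child at the cap ½ still gives at least ¼.
  -- Hence the range from ¼ to ½ for the weights on the tree.
  height-forced : ∀ {v} → ½ ℚ.≤ v → ¼ ℚ.≤ offspring (½ ℚ.- ε) 0ℚ v
  height-forced {v} ½≤v = p+e≡q⇒p≤q
    (0≤p+q (0≤p*q (0≤p+q (ℚ.<⇒≤ 0<½) (ℚ.<⇒≤ 0<ε)) (p≤q⇒0≤q-p ½≤v)) (0≤p*q (ℚ.<⇒≤ 0<½) (ℚ.<⇒≤ 0<ε)))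
    (solve 2 (λ e v →
      con ¼ :+ ((con ½ :+ e) :* (v :- con ½) :+ con ½ :* e) :=
      offspringᵖ (con ½ :- e) (con 0ℚ) v) refl ε v)

  module _ {p : ℕ} (½≤hₚ : ½ ℚ.≤ height p) where

    potential : List (Fin 2) → ℚ
    potential σ with okFrom? p 0 σ
    ... | yes _ = height (phase p σ)
    ... | no  _ = 0ℚ

    potential-∈ : ∀ σ → σ ∈ T p → potential σ ≡ height (phase p σ)
    potential-∈ σ h with okFrom? p 0 σ
    ... | yes _ = refl
    ... | no ¬h = contradiction h ¬h

    potential-∉ : ∀ σ → σ ∉ T p → potential σ ≡ 0ℚ
    potential-∉ σ ¬h with okFrom? p 0 σ
    ... | yes h = contradiction h ¬h
    ... | no _  = refl

    0≤potential : ∀ σ → 0ℚ ℚ.≤ potential σ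
    0≤potential σ with okFrom? p 0 σ
    ... | yes _ = ℚ.≤-trans 0≤¼ (¼≤height (phase p σ))
    ... | no  _ = ℚ.≤-refl

    potential≤1 : ∀ σ → potential σ ℚ.≤ 1ℚ
    potential≤1 σ with okFrom? p 0 σ
    ... | yes _ = ℚ.≤-trans (height≤½ (phase p σ)) ½≤1
    ... | no  _ = ℚ.<⇒≤ 0<1

    potential-child : ∀ σ i → σ ∈ T p → Permits (phase p σ) i →
                      potential (σ ∷ʳ i) ≡ height (countdown p (phase p σ))
    potential-child σ i h q =
      trans (potential-∈ (σ ∷ʳ i) (OkFrom-∷ʳ⁺ p 0 σ i h q)) (cong height (phase-∷ʳ p 0 σ i))

    potential-subharmonic : ∀ σ →
      potential σ ℚ.≤ offspring (½ ℚ.- ε) (potential (σ ∷ʳ 0F)) (potential (σ ∷ʳ 1F))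
    potential-subharmonic σ with okFrom? p 0 σ
    ... | no ¬h = ℚ.≤-reflexive (sym (trans
      (cong₂ (offspring (½ ℚ.- ε)) (potential-∉ (σ ∷ʳ 0F) (λ h → ¬h (T-parent p σ 0F h)))
                                   (potential-∉ (σ ∷ʳ 1F) (λ h → ¬h (T-parent p σ 1F h))))
      (solve 1 (λ c → offspringᵖ c (con 0ℚ) (con 0ℚ) := con 0ℚ) refl (½ ℚ.- ε))))
    ... | yes h = go (phase p σ) refl
      where
      go : ∀ j → phase p σ ≡ j →
           height (phase p σ) ℚ.≤ offspring (½ ℚ.- ε) (potential (σ ∷ʳ 0F)) (potential (σ ∷ʳ 1F))
      -- Child 0 is off the tree; child 1 opens a stretch of `p` free positions, so its weight is
      -- `height p`, which is at least ½.
      go zero eq = subst₂ ℚ._≤_ (sym (cong height eq))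
        (sym (cong₂ (offspring (½ ℚ.- ε))
          (potential-∉ (σ ∷ʳ 0F) (λ h₀ → 0≢1 (subst (λ j → Permits j 0F) eq (proj₂ (OkFrom-∷ʳ⁻ p 0 σ 0F h₀)))))
          (trans (potential-child σ 1F h (subst (λ j → Permits j 1F) (sym eq) refl))
                 (cong (λ j → height (countdown p j)) eq))))
        (height-forced ½≤hₚ)
        where
        0≢1 : ¬ (0F ≡ 1F)
        0≢1 ()
      go (suc j) eq = subst₂ ℚ._≤_ (sym (cong height eq))
        (sym (cong₂ (offspring (½ ℚ.- ε)) (free 0F) (free 1F)))
        (height-free j)
        where
        free : ∀ i → potential (σ ∷ʳ i) ≡ height j
        free i = trans (potential-child σ i h (subst (λ j → Permits j i) (sym eq) tt))
                       (cong (λ j → height (countdown p j)) eq)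

theorem4p4 : ExcludedMiddle (lsuc 0ℓ) →
    (b : ℝ) → ComputableReal b → 0ℝ < b → b < ½ℝ →
    (d : List (Fin 3) → ℝ) →
    (∀ σ → 0ℝ ≤ d σ × d σ ≤ 1ℝ) →
    d [] ≈ 1ℝ →
    (∀ σ → d (σ ∷ʳ 0F) ≈ b * d σ) →
    (∀ σ → d (σ ∷ʳ 1F) ≈ b * d σ) →
    (∀ σ → d (σ ∷ʳ 2F) ≈ (1ℝ - 2ℝ * b) * d σ) →
    ∃[ Q ] (EffectivelyClosed Q ×
    (∀ (leb : BorelProbability 0ℓ (Fin 2)) → IsFairCoin leb → μ leb Q ≈ 0ℝ) ×
    (∀ (μd : BorelProbability (lsuc 0ℓ) (Fin 3)) → HasCylinderValues μd d →
    0ℝ < capacity μd Q))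
-- The gap `ε` contained in `b < ½ℝ` fixes all parameters: `β = ½ - ε`, the increment `δ` of the
-- weights, and through it the length `p` of the free stretches.
theorem4p4 em b _ _ (ε , 0<ε , b+ε≤½) d 0≤d≤1 d[]≈1 d0 d1 d2 with height-reaches-½ 0<ε
... | p , ½≤hₚ =
  Paths (T p) ,
  (T p , ParentClosed⇒IsTree (T-parent p) , T-computable p , (λ h → h) , (λ h → h)) ,
  (λ leb fair → ≅⇒≈ (Paths-null (em-lower em) p leb fair)) ,
  -- The root has phase 0, so its weight, the lower bound for the capacity, computes to `height 0`,
  -- that is ¼.
  λ μd cyl → fromℚ≲⇒0< {¼} (*-pos 0<½ 0<½)
    (h[]≲capacity em {b} {d} (λ σ → proj₁ (0≤d≤1 σ)) d[]≈1 d0 d1 d2 μd cyl b≤½-ε (T-parent p)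
      (potential 0<ε ½≤hₚ) (0≤potential 0<ε ½≤hₚ) (potential≤1 0<ε ½≤hₚ) (potential-∉ 0<ε ½≤hₚ)
      (potential-subharmonic 0<ε ½≤hₚ))
  where
  b≤½-ε : Eventually (λ n → seq b n ℚ.≤ ½ ℚ.- ε)
  b≤½-ε = ev-map (λ n h → subst (ℚ._≤ ½ ℚ.- ε) (solve 2 (λ b e → (b :+ e) :- e := b) refl (seq b n) ε)
    (ℚ.+-monoˡ-≤ (ℚ.- ε) h)) b+ε≤½
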